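{- Let $\mathcal T$ be a subsequential, complete, finally connected and finally aperiodic transducer with an arbitrary finite input alphabet $\mathcal A_I$. The following assertions are equivalent: (a) The asymptotic variance $v_2$ of the output sum is $0$. (b) There exist a state $s$ of the final component and a constant $k\in\mathbb R$ such that $\delta(C)=k\,\mathds{1}(C)$ holds for every closed walk $C$ of the final component visiting the state $s$ exactly once. (c) There exists a constant $k\in\mathbb R$ such that $\delta(C)=k\,\mathds{1}(C)$ holds for every directed cycle $C$ of the final component of $\mathcal T$. In that case, $kn+\mathcal O(1)$ is the expected value of the output sum $\mathsf{Output}(X_n)$, and the statement in (b) holds for all states $s$ of the final component.
   Context: A transducer consists of a finite set of states $\{1,\dots,S\}$, a finite input alphabet $\mathcal A_I\subseteq\mathbb R$, an output alphabet $\mathcal A_O\subseteq\mathbb R$, a set of transitions $\mathcal E\subseteq\{1,\dots,S\}^2\times\mathcal A_I$, output labels $\delta\colon\mathcal E\to\mathcal A_O$, and the initial state $1$. A transition $e=(s,t,\varepsilon)$ goes from $s$ to $t$ and has input label $\varepsilon(e)=\varepsilon$ and output label $\delta(e)$. The underlying graph is the directed multigraph (loops and parallel edges allowed) whose vertices are the states and whose edges are the transitions. The transducer is deterministic if for every state $s$ and $\varepsilon\in\mathcal A_I$ there is at most one $t$ with $(s,t,\varepsilon)\in\mathcal E$; complete if for every $s$ and $\varepsilon\in\mathcal A_I$ there is some $t$ with $(s,t,\varepsilon)\in\mathcal E$; subsequential if it is deterministic, every state is final, and it has a final output $a\colon\{1,\dots,S\}\to\mathcal A_O$. It is finally connected if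 some state can be reached from every other state; its final component is then the transducer induced by the set of all states which can be reached from every other state. A finally connected transducer is finally aperiodic if the underlying graph of the final component is aperiodic (the gcd of the lengths of all closed walks starting and ending at a given vertex is $1$). Throughout, $\mathcal A_I$ has at least two elements. Let $X_n$ be uniformly distributed on $\mathcal A_I^n$. The output of the transducer on an input word is the sequence of output labels along the unique path starting at state $1$ whose input labels are the word (read in a fixed direction, from right to left), together with the final output label of the last state of this path. $\mathsf{Output}(X_n)$ is the sum of the output sequence. There is a constant $v_2$ with $\mathbb V(\mathsf{Output}(X_n))=v_2n+\mathcal O(1)$; it is called the asymptotic variance of the output sum. A cycle is a strongly connected digraph in which every vertex has out-degree $1$ (a loop is a cycle of length $1$). A closed walk is an alternating sequence of vertices and edges $(s_1,e_1,s_2,\dots,e_n,s_{n+1}=s_1)$ such that $e_j$ is an edge from $s_j$ to $s_{j+1}$; it visits $s$ exactly once if exactly one of $s_1,\dots,s_n$ equals $s$. For a function $g$ on transitions and a walk $C$, $g(C)=\sum_{e\in C}g(e)$, counted with multiplicities; $\mathds{1}$ is the constant function $1$, so $\mathds 1(C)$ is the length of $C$. -}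

module Defs where

open import Level using (0ℓ)
open import Algebra.Bundles using (CommutativeRing)
open import Algebra.Core using (Op₁; Op₂)
open import Algebra.Structures using (IsCommutativeRing)
open import Algebra.Definitions.RawMonoid using () renaming (_×_ to multiple)
open import Data.Bool.Base using (Bool; T)
open import Data.Fin.Base using (Fin; zero)
open import Data.Fin.Properties using () renaming (_≟_ to _≟ᶠ_)
open import Data.Fin.Subset using (Subset; Nonempty) renaming (_∈_ to _∈ˢ_)
open import Data.List.Base
  using (List; []; _∷_; _∷ʳ_; map; foldr; filter; length; allFin; cartesianProductWith)
open import Data.List.Membership.Propositional using (_∈_)
open import Data.Nat.Base using (ℕ; suc; _^_) renaming (_≤_ to _≤ℕ_)
open import Data.Nat.Divisibility using (_∣_)
open import Data.Product.Base using (∃; ∃₂; _×_; _,_; proj₁; proj₂)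
open import Data.Vec.Base as Vec using (Vec)
open import Relation.Binary.Core using (Rel)
open import Relation.Binary.Construct.Closure.ReflexiveTransitive using (Star; ε; _◅_; _◅◅_)
open import Relation.Binary.PropositionalEquality.Core using (_≡_)
open import Relation.Binary.Structures using (IsDecTotalOrder)
open import Relation.Nullary.Negation.Core using (¬_)
open import Relation.Unary using (Pred)

-- The real numbers, given axiomatically: complete ordered fields are unique
-- up to isomorphism. As in classical mathematics, the order is decidable.
record CompleteOrderedField : Set₁ where
  infix  8 -_ _⁻¹
  infixl 7 _*_
  infixl 6 _+_ _-_
  infix  4 _≈_ _≤_
  field
    Carrier : Set
    _≈_     : Rel Carrier 0ℓ
    _≤_     : Rel Carrier 0ℓ
    _+_     : Op₂ Carrier
    _*_     : Op₂ Carrier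
    -_      : Op₁ Carrier
    0#      : Carrier
    1#      : Carrier
    -- Nothing is assumed about the inverse of 0#.
    _⁻¹     : Op₁ Carrier

    isCommutativeRing : IsCommutativeRing _≈_ _+_ _*_ -_ 0# 1#
    1≉0               : ¬ (1# ≈ 0#)
    *-inverseʳ        : ∀ x → ¬ (x ≈ 0#) → x * x ⁻¹ ≈ 1#

    isDecTotalOrder   : IsDecTotalOrder _≈_ _≤_
    +-monoˡ-≤         : ∀ z {x y} → x ≤ y → x + z ≤ y + z
    *-nonNegative     : ∀ {x y} → 0# ≤ x → 0# ≤ y → 0# ≤ x * y

  UpperBound : Pred Carrier 0ℓ → Pred Carrier 0ℓ
  UpperBound P b = ∀ x → P x → x ≤ b

  field
    supremum : (P : Pred Carrier 0ℓ) → ∃ P → ∃ (UpperBound P) →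
               ∃ λ s → UpperBound P s × (∀ b → UpperBound P b → s ≤ b)

  commutativeRing : CommutativeRing 0ℓ 0ℓ
  commutativeRing = record { isCommutativeRing = isCommutativeRing }

  _-_ : Op₂ Carrier
  x - y = x + (- y)

  fromℕ : ℕ → Carrier
  fromℕ n = multiple (CommutativeRing.+-rawMonoid commutativeRing) n 1#

  sumList : List Carrier → Carrier
  sumList = foldr _+_ 0#

  -- f n = g n + O(1). A bound for all n is the same as one for all large n.
  _≈_+O[1] : (f g : ℕ → Carrier) → Set
  f ≈ g +O[1] = ∃ λ b → ∀ n → (- b ≤ f n - g n) × (f n - g n ≤ b)

-- A directed multigraph on V is given by its types E s t of edges from s to t.

edges : {V : Set} {E : Rel V 0ℓ} {s t : V} → Star E s t → List (∃₂ E)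
edges ε       = []
edges (e ◅ p) = (_ , _ , e) ∷ edges p

source : {V : Set} {E : Rel V 0ℓ} → ∃₂ E → V
source (s , _ , _) = s

target : {V : Set} {E : Rel V 0ℓ} → ∃₂ E → V
target (_ , t , _) = t

outDegree : ∀ {m} {E : Rel (Fin m) 0ℓ} → List (∃₂ E) → Fin m → ℕ
outDegree es v = length (filter (λ e → source e ≟ᶠ v) es)

-- The sources of the edges of a closed walk are its vertices s₁, …, sₙ
-- (without sₙ₊₁ = s₁).
VisitsExactlyOnce : ∀ {m} {E : Rel (Fin m) 0ℓ} {u : Fin m} → Fin m → Star E u u → Set
VisitsExactlyOnce v p = length (filter (_≟ᶠ v) (map source (edges p))) ≡ 1

-- The greatest common divisor is taken of a possibly infinite set, so that it
-- is 1 is expressed by the common divisors.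
PeriodOne : {V : Set} → Rel V 0ℓ → Pred V 0ℓ
PeriodOne E v = ∀ d → ((C : Star E v v) → d ∣ length (edges C)) → d ≡ 1

-- The subgraph induced by the vertices in P.
Induced : {V : Set} → Pred V 0ℓ → Rel V 0ℓ → Rel V 0ℓ
Induced P E s t = P s × P t × E s t

-- A subgraph of E that is strongly connected and has all out-degrees 1. The
-- last condition also prevents an edge from being listed twice.
record Cycle {m} (E : Rel (Fin m) 0ℓ) : Set where
  field
    vertices : Subset m
    edgeList : List (∃₂ E)
    nonempty : Nonempty vertices
    sources∈ : ∀ {e} → e ∈ edgeList → source e ∈ˢ vertices
    targets∈ : ∀ {e} → e ∈ edgeList → target e ∈ˢ vertices
    outDeg≡1 : ∀ {v} → v ∈ˢ vertices → outDegree edgeList v ≡ 1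

  SubEdge : Rel (Fin m) 0ℓ
  SubEdge s t = ∃ λ (e : E s t) → (s , t , e) ∈ edgeList

  field
    stronglyConnected : ∀ {u v} → u ∈ˢ vertices → v ∈ˢ vertices → Star SubEdge u v

-- The states 1, …, S are the elements of Fin S with S = suc S-1, and the input
-- alphabet is {letterValue i | i : Fin numLetters}. Output labels are arbitrary
-- reals.
record Transducer (ℝ : CompleteOrderedField) : Set where
  open CompleteOrderedField ℝ using (Carrier; _≈_)
  field
    S-1         : ℕ
    numLetters  : ℕ
    2≤letters   : 2 ≤ℕ numLetters
    letterValue : Fin numLetters → Carrier
    injective   : ∀ {i j} → letterValue i ≈ letterValue j → i ≡ j

  State : Set
  State = Fin (suc S-1)

  Letter : Set
  Letter = Fin numLetters

  initial : State
  initial = zero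

  field
    isTransition : State → State → Letter → Bool

  Edge : Rel State 0ℓ
  Edge s t = ∃ λ x → T (isTransition s t x)

  field
    δ : ∀ {s t} → Edge s t → Carrier

  Walk : Rel State 0ℓ
  Walk = Star Edge

  Deterministic : Set
  Deterministic = ∀ s x t t′ → T (isTransition s t x) → T (isTransition s t′ x) → t ≡ t′

  Complete : Set
  Complete = ∀ s x → ∃ λ t → T (isTransition s t x)

  -- Every state is final: the final output is defined on all states.
  record Subsequential : Set where
    field
      deterministic : Deterministic
      finalOutput   : State → Carrier

  InFinalComponent : Pred State 0ℓ
  InFinalComponent t = ∀ s → Walk s t

  FinallyConnected : Set
  FinallyConnected = ∃ InFinalComponent

  FinalEdge : Rel State 0ℓ
  FinalEdge = Induced InFinalComponent Edge

  FinallyAperiodic : Set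
  FinallyAperiodic = ∀ s → InFinalComponent s → PeriodOne FinalEdge s

module _ {ℝ : CompleteOrderedField} (𝒯 : Transducer ℝ) where
  open CompleteOrderedField ℝ
  open Transducer 𝒯

  δ[_] : List (∃₂ FinalEdge) → Carrier
  δ[ es ] = sumList (map (λ (_ , _ , _ , _ , e) → δ e) es)

  𝟙[_] : List (∃₂ FinalEdge) → Carrier
  𝟙[ es ] = sumList (map (λ _ → 1#) es)

  ClosedWalksProportional : State → Carrier → Set
  ClosedWalksProportional s k =
    ∀ {u} (C : Star FinalEdge u u) → VisitsExactlyOnce s C →
    δ[ edges C ] ≈ k * 𝟙[ edges C ]

  CyclesProportional : Carrier → Set
  CyclesProportional k =
    (C : Cycle FinalEdge) → let open Cycle C in δ[ edgeList ] ≈ k * 𝟙[ edgeList ]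

  -- The input word is read from right to left, i.e. the head of the vector is
  -- read last. For a deterministic transducer the path is the only one with
  -- this input.
  path : Complete → ∀ {n} → Vec Letter n → ∃ (Walk initial)
  path complete Vec.[]      = initial , ε
  path complete (x Vec.∷ w) =
    let s , p = path complete w
        t , e = complete s x
    in t , p ◅◅ ((x , e) ◅ ε)

  words : ∀ n → List (Vec Letter n)
  words 0       = Vec.[] ∷ []
  words (suc n) = cartesianProductWith Vec._∷_ (allFin numLetters) (words n)

  -- Expected value of f(X) for X uniformly distributed on the words of length n.
  𝔼 : ∀ n → (Vec Letter n → Carrier) → Carrier
  𝔼 n f = fromℕ (numLetters ^ n) ⁻¹ * sumList (map f (words n))

  𝕍 : ∀ n → (Vec Letter n → Carrier) → Carrier
  𝕍 n f = 𝔼 n (λ w → (f w - 𝔼 n f) * (f w - 𝔼 n f))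

  module _ (subsequential : Subsequential) (complete : Complete) where
    open Subsequential subsequential

    outputSequence : ∀ {n} → Vec Letter n → List Carrier
    outputSequence w =
      let t , p = path complete w
      in map (λ (_ , _ , e) → δ e) (edges p) ∷ʳ finalOutput t

    Output : ∀ {n} → Vec Letter n → Carrier
    Output w = sumList (outputSequence w)

    IsAsymptoticVariance : Carrier → Set
    IsAsymptoticVariance v₂ = (λ n → 𝕍 n Output) ≈ (λ n → v₂ * fromℕ n) +O[1]

    -- The expected value of the output sum is kn + O(1).
    ExpectedOutputRate : Carrier → Set
    ExpectedOutputRate k = (λ n → 𝔼 n Output) ≈ (λ n → k * fromℕ n) +O[1]

{-# OPTIONS --safe #-}
module Submission where

-- Call k balanced if δ - k sums to zero over every closed walk of the final
-- component. By erasing loops, respectively returns to s, both (c) and (b) say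
-- that k is balanced; conversely a balanced k makes δ - k the difference of a
-- potential, which gives (c). The potential also shows that Output - k n is
-- bounded by a multiple of the number of steps spent outside of the final
-- component. That number has bounded second moment by a Lyapunov function
-- argument, whence the bounded variance and the expected value k n + O(1).
--
-- If no k is balanced, there are two closed walks of equal length at one state
-- with different outputs. As this state is reached from everywhere, for a
-- suitable L every state has two words of length L that lead to the same state
-- with outputs differing by a fixed d ≠ 0. Every block of L letters then adds
-- a fixed positive amount to the variance.

open import Defs
open import Level using (0ℓ)
open import Algebra.Bundles using (CommutativeRing)
open import Algebra.Solver.Ring.AlmostCommutativeRing
  using (fromCommutativeRing; _-Raw-AlmostCommutative⟶_)
open import Data.Bool.Base using (T)
open import Data.Bool.Properties using (T-irrelevant)
open import Data.Empty using (⊥-elim)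
open import Data.Fin.Base using (Fin; zero; suc; fromℕ<)
open import Data.Fin.Properties using (any?) renaming (_≟_ to _≟ᶠ_)
open import Data.Fin.Subset using (Subset) renaming (_∈_ to _∈ˢ_)
open import Data.List.Base
  using (List; []; _∷_; _∷ʳ_; _++_; map; length; filter; allFin; cartesianProductWith)
open import Data.List.Membership.DecPropositional using () renaming (_∈?_ to mem?)
open import Data.List.Membership.Propositional using (_∈_; find)
open import Data.List.Membership.Propositional.Properties
  using (∈-∃++; ∈-map⁺; ∈-map⁻; ∈-allFin; ∈-cartesianProductWith⁺)
open import Data.List.Properties
  using (filter-accept; filter-reject; length-map; length-++; length-tabulate; ++-identityʳ)
open import Data.List.Relation.Binary.Permutation.Propositional as ↭ using (_↭_; ↭-sym; ↭-trans)
open import Data.List.Relation.Binary.Permutation.Propositional.Properties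
  using (shift; ↭-length; ∈-resp-↭)
open import Data.List.Relation.Binary.Subset.Propositional using (_⊆_)
open import Data.List.Relation.Unary.All as All using ([]; _∷_)
open import Data.List.Relation.Unary.All.Properties using (¬Any⇒All¬)
open import Data.List.Relation.Unary.AllPairs using ([]; _∷_)
open import Data.List.Relation.Unary.Any as Any using (here; there)
open import Data.List.Relation.Unary.Unique.Propositional using (Unique)
open import Data.Maybe.Base using (Maybe; just; nothing)
open import Data.Nat.Base as ℕ using (ℕ; zero; suc; z≤n; s≤s)
open import Data.Nat.ListAction using (sum)
import Data.Nat.Properties as ℕₚ
open import Data.Product using (∃; ∃-syntax; ∃₂; _×_; _,_; proj₁; proj₂)
open import Data.Sum using (_⊎_; inj₁; inj₂)
open import Data.Vec.Base as Vec using (Vec)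
import Data.Vec.Properties as Vecₚ
open import Function.Base using (id)
open import Function.Bundles using (_⇔_; mk⇔)
open import Relation.Binary.Construct.Closure.ReflexiveTransitive using (Star; ε; _◅_; _◅◅_)
open import Relation.Binary.Core using (Rel)
open import Relation.Binary.PropositionalEquality as ≡ using (_≡_; _≢_)
open import Relation.Binary.Structures using (IsDecTotalOrder)
open import Relation.Nullary using (¬_; ¬?; Dec; yes; no; does)
open import Relation.Nullary.Decidable using (dec-true; map′; decidable-stable)
open import Relation.Unary using (Pred; Decidable)

-- Successive blocks are not independent: the state at the end of a block influences all later
-- output. Two features deal with this. Both words of a fork end in the same state, so exchanging
-- them leaves the later output alone; and the induction over blocks is carried out for sums of
-- squares with an arbitrary function of the end state added, which absorbs the mean of the
-- following block. In the other direction, a bounded mean for the number of steps outside of the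
-- final component would not suffice, since its square enters the variance. The Lyapunov function is
-- therefore quadratic in this number. Membership in the final component speaks about all walks and
-- comes without a decision procedure, whereas the potential and the count of outside steps are
-- defined by cases on it. Listing the states reachable from one final state supplies the decision.
-- Words are read from right to left, so `x ∷ w` adds a letter at the end of a run and `w ∷ʳ x` at
-- its start. Estimates over time use the former, constructions of words along walks the latter.

module OrderedField (ℝ : CompleteOrderedField) where
  open import Data.Integer.Base as ℤ using (ℤ; +_; -[1+_])
  import Data.Integer.Properties as ℤₚ
  open CompleteOrderedField ℝ public
  open CommutativeRing commutativeRing public
    using (refl; sym; trans; reflexive; setoid; +-cong; +-congˡ; +-congʳ; *-cong; *-congˡ; *-congʳ; -‿cong;
           +-identityˡ; +-identityʳ; *-identityˡ; +-comm; +-assoc; *-assoc;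
           distribˡ; zeroˡ; zeroʳ; -‿inverseʳ; semiring; ring)
  open IsDecTotalOrder isDecTotalOrder public
    using (_≟_; total; antisym; ≤-respˡ-≈; ≤-respʳ-≈)
    renaming (refl to ≤-refl; trans to ≤-trans; reflexive to ≤-reflexive)
  open import Algebra.Properties.Ring ring
    using (-‿+-comm; -‿involutive; -‿distribˡ-*; -‿distribʳ-*; -0#≈0#)
  open import Algebra.Properties.Semiring.Mult.TCOptimised semiring
    using (×-homo-+; ×1-homo-*; 1+×) renaming (_×_ to _·_)
  open import Algebra.Properties.Semiring.Mult semiring as Mult using ()
  open import Relation.Binary.Reasoning.Setoid setoid

  -- Integer coefficients for the ring solver

  private
    -- Integers have computing equality, so the solver can cancel coefficients. With the optimised
    -- multiple, 1 is sent to `1#` itself, and `fromℕ (suc n)` can be written as `𝟙 :+ n`.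
    fromℤ : ℤ → Carrier
    fromℤ (+ n)    = n · 1#
    fromℤ -[1+ n ] = - (suc n · 1#)

    neg-homo : ∀ i → fromℤ (ℤ.- i) ≈ - fromℤ i
    neg-homo (+ zero)  = sym -0#≈0#
    neg-homo (+ suc n) = refl
    neg-homo -[1+ n ]  = sym (-‿involutive _)

    ⊖-homo : ∀ m n → fromℤ (m ℤ.⊖ n) ≈ m · 1# + (- (n · 1#))
    ⊖-homo m zero = begin
      fromℤ (m ℤ.⊖ 0)   ≡⟨ ≡.cong fromℤ (ℤₚ.⊖-≥ {m} z≤n) ⟩
      m · 1#            ≈⟨ +-identityʳ _ ⟨
      m · 1# + 0#       ≈⟨ +-congˡ -0#≈0# ⟨
      m · 1# + (- 0#)   ∎
    ⊖-homo zero (suc n) = sym (+-identityˡ _)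
    ⊖-homo (suc m) (suc n) = begin
      fromℤ (suc m ℤ.⊖ suc n)                  ≡⟨ ≡.cong fromℤ (ℤₚ.[1+m]⊖[1+n]≡m⊖n m n) ⟩
      fromℤ (m ℤ.⊖ n)                          ≈⟨ ⊖-homo m n ⟩
      m · 1# + (- (n · 1#))                    ≈⟨ +-identityˡ _ ⟨
      0# + (m · 1# + (- (n · 1#)))             ≈⟨ +-congʳ (-‿inverseʳ 1#) ⟨
      (1# + (- 1#)) + (m · 1# + (- (n · 1#)))  ≈⟨ shuffle ⟩
      (1# + m · 1#) + ((- 1#) + (- (n · 1#)))
        ≈⟨ +-cong (sym (1+× m 1#)) (trans (-‿+-comm _ _) (-‿cong (sym (1+× n 1#)))) ⟩
      suc m · 1# + (- (suc n · 1#))            ∎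
      where
      open import Algebra.Properties.CommutativeSemigroup
        (CommutativeRing.+-commutativeSemigroup commutativeRing) using (interchange)
      shuffle = interchange 1# (- 1#) (m · 1#) (- (n · 1#))

    +-homo : ∀ i j → fromℤ (i ℤ.+ j) ≈ fromℤ i + fromℤ j
    +-homo (+ m)    (+ n)    = ×-homo-+ 1# m n
    +-homo (+ m)    -[1+ n ] = ⊖-homo m (suc n)
    +-homo -[1+ m ] (+ n)    = trans (⊖-homo n (suc m)) (+-comm _ _)
    +-homo -[1+ m ] -[1+ n ] = begin
      - (suc (suc (m ℕ.+ n)) · 1#)
        ≡⟨ ≡.cong (λ l → - (l · 1#)) (≡.cong suc (≡.sym (ℕₚ.+-suc m n))) ⟩
      - ((suc m ℕ.+ suc n) · 1#)                  ≈⟨ -‿cong (×-homo-+ 1# (suc m) (suc n)) ⟩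
      - (suc m · 1# + suc n · 1#)                 ≈⟨ -‿+-comm _ _ ⟨
      (- (suc m · 1#)) + (- (suc n · 1#))         ∎

    *-homo-+ : ∀ i n → fromℤ (i ℤ.* + n) ≈ fromℤ i * fromℤ (+ n)
    *-homo-+ (+ m) n = begin
      fromℤ (+ m ℤ.* + n)      ≡⟨ ≡.cong fromℤ (ℤₚ.pos-* m n) ⟨
      (m ℕ.* n) · 1#           ≈⟨ ×1-homo-* m n ⟩
      m · 1# * (n · 1#)        ∎
    *-homo-+ -[1+ m ] n = begin
      fromℤ (-[1+ m ] ℤ.* + n)         ≡⟨ ≡.cong fromℤ (ℤₚ.neg-distribˡ-* (+ suc m) (+ n)) ⟨
      fromℤ (ℤ.- (+ suc m ℤ.* + n))    ≈⟨ neg-homo (+ suc m ℤ.* + n) ⟩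
      - fromℤ (+ suc m ℤ.* + n)        ≈⟨ -‿cong (*-homo-+ (+ suc m) n) ⟩
      - (suc m · 1# * (n · 1#))        ≈⟨ -‿distribˡ-* _ _ ⟩
      (- (suc m · 1#)) * (n · 1#)      ∎

    *-homo : ∀ i j → fromℤ (i ℤ.* j) ≈ fromℤ i * fromℤ j
    *-homo i (+ n)    = *-homo-+ i n
    *-homo i -[1+ n ] = begin
      fromℤ (i ℤ.* -[1+ n ])           ≡⟨ ≡.cong fromℤ (ℤₚ.neg-distribʳ-* i (+ suc n)) ⟨
      fromℤ (ℤ.- (i ℤ.* + suc n))      ≈⟨ neg-homo (i ℤ.* + suc n) ⟩
      - fromℤ (i ℤ.* + suc n)          ≈⟨ -‿cong (*-homo-+ i (suc n)) ⟩
      - (fromℤ i * (suc n · 1#))       ≈⟨ -‿distribʳ-* _ _ ⟩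
      fromℤ i * (- (suc n · 1#))       ∎

    fromℤ-morphism : ℤ.+-*-rawRing -Raw-AlmostCommutative⟶ fromCommutativeRing commutativeRing
    fromℤ-morphism = record
      { ⟦_⟧    = fromℤ
      ; +-homo = +-homo
      ; *-homo = *-homo
      ; -‿homo = neg-homo
      ; 0-homo = refl
      ; 1-homo = refl
      }

    fromℤ-≟ : ∀ i j → Maybe (fromℤ i ≈ fromℤ j)
    fromℤ-≟ i j with i ℤₚ.≟ j
    ... | yes i≡j = just (reflexive (≡.cong fromℤ i≡j))
    ... | no  _   = nothing

  module Solver where
    open import Algebra.Solver.Ring ℤ.+-*-rawRing (fromCommutativeRing commutativeRing)
      fromℤ-morphism fromℤ-≟ public
    infixl 7 _⊝_
    _⊝_ : ∀ {n} → Polynomial n → Polynomial n → Polynomial n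
    p ⊝ q = p :+ (:- q)
    𝟘 𝟙 : ∀ {n} → Polynomial n
    𝟘 = con (+ 0)
    𝟙 = con (+ 1)

  open Solver using (solve; _:=_; _:+_; _:*_; :-_; _⊝_; 𝟘; 𝟙)

  -- Inequalities, inverses and bounds in the ordered field

  x≤y⇒0≤y-x : ∀ {x y} → x ≤ y → 0# ≤ y - x
  x≤y⇒0≤y-x {x} x≤y = ≤-respˡ-≈ (-‿inverseʳ x) (+-monoˡ-≤ (- x) x≤y)

  0≤y-x⇒x≤y : ∀ {x y} → 0# ≤ y - x → x ≤ y
  0≤y-x⇒x≤y {x} {y} 0≤y-x = ≤-respˡ-≈ (+-identityˡ x)
    (≤-respʳ-≈ (solve 2 (λ x y → (y ⊝ x) :+ x := y) refl x y) (+-monoˡ-≤ x 0≤y-x))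

  +-mono-≤ : ∀ {x y u v} → x ≤ y → u ≤ v → x + u ≤ y + v
  +-mono-≤ {x} {y} {u} {v} x≤y u≤v = ≤-trans (+-monoˡ-≤ u x≤y)
    (≤-respˡ-≈ (+-comm u y) (≤-respʳ-≈ (+-comm v y) (+-monoˡ-≤ y u≤v)))

  +-nonNegative : ∀ {x y} → 0# ≤ x → 0# ≤ y → 0# ≤ x + y
  +-nonNegative 0≤x 0≤y = ≤-respˡ-≈ (+-identityˡ 0#) (+-mono-≤ 0≤x 0≤y)

  -- Inequalities are proved by exhibiting the difference of the two sides as a
  -- non-negative term, which leaves a ring identity.
  ≤-by-difference : ∀ {x y z} → 0# ≤ z → y ≈ x + z → x ≤ y
  ≤-by-difference {x} {y} {z} 0≤z y≈x+z = 0≤y-x⇒x≤y (≤-respʳ-≈ (sym (begin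
    y - x      ≈⟨ +-congʳ y≈x+z ⟩
    x + z - x  ≈⟨ solve 2 (λ x z → x :+ z ⊝ x := z) refl x z ⟩
    z          ∎)) 0≤z)

  neg-mono-≤ : ∀ {x y} → x ≤ y → - y ≤ - x
  neg-mono-≤ {x} {y} x≤y = ≤-by-difference (x≤y⇒0≤y-x x≤y)
    (solve 2 (λ x y → :- x := :- y :+ (y ⊝ x)) refl x y)

  *-monoˡ-≤ : ∀ {x y} z → 0# ≤ z → x ≤ y → z * x ≤ z * y
  *-monoˡ-≤ {x} {y} z 0≤z x≤y = ≤-by-difference (*-nonNegative 0≤z (x≤y⇒0≤y-x x≤y))
    (solve 3 (λ x y z → z :* y := z :* x :+ z :* (y ⊝ x)) refl x y z)

  square-nonNegative : ∀ x → 0# ≤ x * x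
  square-nonNegative x with total 0# x
  ... | inj₁ 0≤x = *-nonNegative 0≤x 0≤x
  ... | inj₂ x≤0 = ≤-respʳ-≈ (solve 1 (λ x → (𝟘 ⊝ x) :* (𝟘 ⊝ x) := x :* x) refl x)
                     (*-nonNegative (x≤y⇒0≤y-x x≤0) (x≤y⇒0≤y-x x≤0))

  0≤1 : 0# ≤ 1#
  0≤1 = ≤-respʳ-≈ (*-identityˡ 1#) (square-nonNegative 1#)

  0≤x≤0⇒x≈0 : ∀ {x} → 0# ≤ x → x ≤ 0# → x ≈ 0#
  0≤x≤0⇒x≈0 0≤x x≤0 = antisym x≤0 0≤x

  1≤x⇒x≉0 : ∀ {x} → 1# ≤ x → ¬ (x ≈ 0#)
  1≤x⇒x≉0 1≤x x≈0 = 1≉0 (0≤x≤0⇒x≈0 0≤1 (≤-respʳ-≈ x≈0 1≤x))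

  ⁻¹-nonNegative : ∀ {x} → 0# ≤ x → ¬ (x ≈ 0#) → 0# ≤ x ⁻¹
  ⁻¹-nonNegative {x} 0≤x x≉0 with total 0# (x ⁻¹)
  ... | inj₁ 0≤x⁻¹ = 0≤x⁻¹
  ... | inj₂ x⁻¹≤0 = ⊥-elim (1≤x⇒x≉0 ≤-refl (0≤x≤0⇒x≈0 0≤1
    (0≤y-x⇒x≤y (≤-respʳ-≈ (begin
      x * (0# - x ⁻¹)  ≈⟨ solve 2 (λ x y → x :* (𝟘 ⊝ y) := 𝟘 ⊝ x :* y) refl x (x ⁻¹) ⟩
      0# - x * x ⁻¹    ≈⟨ +-congˡ (-‿cong (*-inverseʳ x x≉0)) ⟩
      0# - 1#          ∎) (*-nonNegative 0≤x (x≤y⇒0≤y-x x⁻¹≤0))))))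

  *-inverseˡ-cancel : ∀ {x} y → ¬ (x ≈ 0#) → x ⁻¹ * (x * y) ≈ y
  *-inverseˡ-cancel {x} y x≉0 = begin
    x ⁻¹ * (x * y)  ≈⟨ solve 3 (λ x y z → z :* (x :* y) := (x :* z) :* y) refl x y (x ⁻¹) ⟩
    (x * x ⁻¹) * y  ≈⟨ *-congʳ (*-inverseʳ x x≉0) ⟩
    1# * y          ≈⟨ *-identityˡ y ⟩
    y               ∎

  *-cancelˡ-≈ : ∀ {x y z} → ¬ (x ≈ 0#) → x * y ≈ x * z → y ≈ z
  *-cancelˡ-≈ {x} {y} {z} x≉0 xy≈xz =
    trans (sym (*-inverseˡ-cancel y x≉0)) (trans (*-congˡ xy≈xz) (*-inverseˡ-cancel z x≉0))

  *-cancelˡ-≤ : ∀ {x y z} → 0# ≤ x → ¬ (x ≈ 0#) → x * y ≤ x * z → y ≤ z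
  *-cancelˡ-≤ {x} {y} {z} 0≤x x≉0 xy≤xz =
    ≤-respˡ-≈ (*-inverseˡ-cancel y x≉0) (≤-respʳ-≈ (*-inverseˡ-cancel z x≉0)
      (*-monoˡ-≤ (x ⁻¹) (⁻¹-nonNegative 0≤x x≉0) xy≤xz))

  x*x≈0⇒x≈0 : ∀ {x} → x * x ≈ 0# → x ≈ 0#
  x*x≈0⇒x≈0 {x} x²≈0 with x ≟ 0#
  ... | yes x≈0 = x≈0
  ... | no  x≉0 = ⊥-elim (x≉0 (*-cancelˡ-≈ x≉0 (trans x²≈0 (sym (zeroʳ x)))))

  x-y≈0⇒x≈y : ∀ {x y} → x - y ≈ 0# → x ≈ y
  x-y≈0⇒x≈y {x} {y} x-y≈0 = begin
    x          ≈⟨ solve 2 (λ x y → x := (x ⊝ y) :+ y) refl x y ⟩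
    x - y + y  ≈⟨ +-congʳ x-y≈0 ⟩
    0# + y     ≈⟨ +-identityˡ y ⟩
    y          ∎

  x≈y⇒x-y≈0 : ∀ {x y} → x ≈ y → x - y ≈ 0#
  x≈y⇒x-y≈0 {x} {y} x≈y = trans (+-congʳ x≈y) (-‿inverseʳ y)

  fromℕ-+ : ∀ m n → fromℕ (m ℕ.+ n) ≈ fromℕ m + fromℕ n
  fromℕ-+ = Mult.×-homo-+ 1#

  fromℕ-* : ∀ m n → fromℕ (m ℕ.* n) ≈ fromℕ m * fromℕ n
  fromℕ-* = Mult.×1-homo-*

  fromℕ-nonNegative : ∀ n → 0# ≤ fromℕ n
  fromℕ-nonNegative zero    = ≤-refl
  fromℕ-nonNegative (suc n) = +-nonNegative 0≤1 (fromℕ-nonNegative n)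

  fromℕ-mono-≤ : ∀ {m n} → m ℕ.≤ n → fromℕ m ≤ fromℕ n
  fromℕ-mono-≤ {n = n} z≤n = fromℕ-nonNegative n
  fromℕ-mono-≤ (s≤s m≤n) = +-mono-≤ ≤-refl (fromℕ-mono-≤ m≤n)

  fromℕ≉0 : ∀ {n} → 1 ℕ.≤ n → ¬ (fromℕ n ≈ 0#)
  fromℕ≉0 1≤n = 1≤x⇒x≉0 (≤-respˡ-≈ (+-identityʳ 1#) (fromℕ-mono-≤ 1≤n))

  -- If x were positive, then s - x would be a smaller upper bound of the
  -- multiples of x than their supremum s.
  archimedean : ∀ {x b} → 0# ≤ x → (∀ n → fromℕ n * x ≤ b) → x ≈ 0#
  archimedean {x} {b} 0≤x bounded with supremum (λ y → ∃[ n ] y ≈ fromℕ n * x)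
    (0# , 0 , sym (zeroˡ x)) (b , λ { y (n , y≈nx) → ≤-respˡ-≈ (sym y≈nx) (bounded n) })
  ... | s , upper , least = 0≤x≤0⇒x≈0 0≤x (≤-by-difference (x≤y⇒0≤y-x s≤s-x)
          (solve 2 (λ s x → 𝟘 := x :+ ((s ⊝ x) ⊝ s)) refl s x))
    where
    s≤s-x : s ≤ s - x
    s≤s-x = least (s - x) λ { y (n , y≈nx) → ≤-respˡ-≈ (sym y≈nx)
      (≤-by-difference (x≤y⇒0≤y-x (upper _ (suc n , refl)))
        (solve 3 (λ s x n → s ⊝ x := n :* x :+ (s ⊝ (𝟙 :+ n) :* x)) refl s x (fromℕ n))) }

  infix 4 ∣_∣≤_
  -- This is literally the pair of inequalities in `_≈_+O[1]`, so bounds of this form prove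
  -- asymptotic statements without conversion.
  ∣_∣≤_ : Carrier → Carrier → Set
  ∣ x ∣≤ b = (- b ≤ x) × (x ≤ b)

  ∣∣≤-resp : ∀ {x y b} → x ≈ y → ∣ x ∣≤ b → ∣ y ∣≤ b
  ∣∣≤-resp x≈y (-b≤x , x≤b) = ≤-respʳ-≈ x≈y -b≤x , ≤-respˡ-≈ x≈y x≤b

  ∣∣≤-mono : ∀ {x b c} → b ≤ c → ∣ x ∣≤ b → ∣ x ∣≤ c
  ∣∣≤-mono b≤c (-b≤x , x≤b) = ≤-trans (neg-mono-≤ b≤c) -b≤x , ≤-trans x≤b b≤c

  ∣∣≤-+ : ∀ {x y b c} → ∣ x ∣≤ b → ∣ y ∣≤ c → ∣ x + y ∣≤ b + c
  ∣∣≤-+ (-b≤x , x≤b) (-c≤y , y≤c) = ≤-respˡ-≈ (-‿+-comm _ _) (+-mono-≤ -b≤x -c≤y) , +-mono-≤ x≤b y≤c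

  -- The difference of the squares is `(x + b) * (b - x)`, and each half of the hypothesis makes one
  -- factor non-negative.
  ∣∣≤-square : ∀ {x b} → ∣ x ∣≤ b → x * x ≤ b * b
  ∣∣≤-square {x} {b} (-b≤x , x≤b) = ≤-by-difference
    (*-nonNegative (x≤y⇒0≤y-x -b≤x) (x≤y⇒0≤y-x x≤b))
    (solve 2 (λ x b → b :* b := x :* x :+ (x ⊝ :- b) :* (b ⊝ x)) refl x b)

  ∣∣-bounded : ∀ x → ∃[ b ] 0# ≤ b × ∣ x ∣≤ b
  ∣∣-bounded x with total 0# x
  ... | inj₁ 0≤x = x , 0≤x , ≤-by-difference (+-nonNegative 0≤x 0≤x)
                     (solve 1 (λ x → x := :- x :+ (x :+ x)) refl x) , ≤-refl
  ... | inj₂ x≤0 = 0# - x , 0≤-x , ≤-by-difference ≤-refl (solve 1 (λ x → x := :- (𝟘 ⊝ x) :+ 𝟘) refl x)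
                     , ≤-trans x≤0 0≤-x
    where 0≤-x = x≤y⇒0≤y-x x≤0

  ∣∣-boundedOnFin : ∀ {m} (f : Fin m → Carrier) → ∃[ b ] 0# ≤ b × (∀ i → ∣ f i ∣≤ b)
  ∣∣-boundedOnFin {zero}  f = 0# , ≤-refl , λ ()
  ∣∣-boundedOnFin {suc m} f with ∣∣-bounded (f zero) | ∣∣-boundedOnFin (λ i → f (suc i))
  ... | b , 0≤b , f₀≤b | c , 0≤c , fₛ≤c = b + c , +-nonNegative 0≤b 0≤c , λ where
    zero    → ∣∣≤-mono (≤-by-difference 0≤c refl) f₀≤b
    (suc i) → ∣∣≤-mono (≤-by-difference 0≤b (+-comm b c)) (fₛ≤c i)

  -- Finite sums

  module _ {A : Set} where

    Σ[_] : List A → (A → Carrier) → Carrier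
    Σ[ xs ] f = sumList (map f xs)

    Σ-cong : ∀ xs {f g : A → Carrier} → (∀ x → f x ≈ g x) → Σ[ xs ] f ≈ Σ[ xs ] g
    Σ-cong []       f≈g = refl
    Σ-cong (x ∷ xs) f≈g = +-cong (f≈g x) (Σ-cong xs f≈g)

    Σ-mono : ∀ xs {f g : A → Carrier} → (∀ x → f x ≤ g x) → Σ[ xs ] f ≤ Σ[ xs ] g
    Σ-mono []       f≤g = ≤-refl
    Σ-mono (x ∷ xs) f≤g = +-mono-≤ (f≤g x) (Σ-mono xs f≤g)

    Σ-+ : ∀ xs (f g : A → Carrier) → Σ[ xs ] (λ x → f x + g x) ≈ Σ[ xs ] f + Σ[ xs ] g
    Σ-+ []       f g = sym (+-identityˡ 0#)
    Σ-+ (x ∷ xs) f g = trans (+-congˡ (Σ-+ xs f g))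
      (solve 4 (λ a b c d → a :+ b :+ (c :+ d) := a :+ c :+ (b :+ d)) refl (f x) (g x) (Σ[ xs ] f) (Σ[ xs ] g))

    Σ-* : ∀ xs c (f : A → Carrier) → Σ[ xs ] (λ x → c * f x) ≈ c * Σ[ xs ] f
    Σ-* []       c f = sym (zeroʳ c)
    Σ-* (x ∷ xs) c f = trans (+-congˡ (Σ-* xs c f)) (sym (distribˡ c _ _))

    Σ-const : ∀ (xs : List A) c → Σ[ xs ] (λ _ → c) ≈ fromℕ (length xs) * c
    Σ-const []       c = sym (zeroˡ c)
    Σ-const (x ∷ xs) c = trans (+-congˡ (Σ-const xs c))
      (solve 2 (λ c n → c :+ n :* c := (𝟙 :+ n) :* c) refl c (fromℕ (length xs)))

    Σ-++ : ∀ xs ys (f : A → Carrier) → Σ[ xs ++ ys ] f ≈ Σ[ xs ] f + Σ[ ys ] f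
    Σ-++ []       ys f = sym (+-identityˡ _)
    Σ-++ (x ∷ xs) ys f = trans (+-congˡ (Σ-++ xs ys f)) (sym (+-assoc _ _ _))

    Σ-nonNegative : ∀ xs {f : A → Carrier} → (∀ x → 0# ≤ f x) → 0# ≤ Σ[ xs ] f
    Σ-nonNegative []       0≤f = ≤-refl
    Σ-nonNegative (x ∷ xs) 0≤f = +-nonNegative (0≤f x) (Σ-nonNegative xs 0≤f)

    Σ-member-≤ : ∀ {x xs} {f : A → Carrier} → (∀ x → 0# ≤ f x) → x ∈ xs → f x ≤ Σ[ xs ] f
    Σ-member-≤ {xs = _ ∷ xs} 0≤f (here ≡.refl) = ≤-by-difference (Σ-nonNegative xs 0≤f) refl
    Σ-member-≤ {xs = y ∷ _}  0≤f (there x∈xs)  =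
      ≤-trans (Σ-member-≤ 0≤f x∈xs) (≤-by-difference (0≤f y) (+-comm _ _))

  Σ-map : ∀ {A B : Set} xs (g : A → B) (f : B → Carrier) → Σ[ map g xs ] f ≡ Σ[ xs ] (λ x → f (g x))
  Σ-map []       g f = ≡.refl
  Σ-map (x ∷ xs) g f = ≡.cong (λ y → f (g x) + y) (Σ-map xs g f)

  Σ-swap : ∀ {A B : Set} (xs : List A) (ys : List B) (f : A → B → Carrier) →
           Σ[ xs ] (λ x → Σ[ ys ] (f x)) ≈ Σ[ ys ] (λ y → Σ[ xs ] (λ x → f x y))
  Σ-swap []       ys f = sym (trans (Σ-const ys 0#) (zeroʳ _))
  Σ-swap (x ∷ xs) ys f = trans (+-congˡ (Σ-swap xs ys f)) (sym (Σ-+ ys (f x) _))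

  Σ-cartesianProductWith : ∀ {A B C : Set} (g : A → B → C) (xs : List A) (ys : List B) (f : C → Carrier) →
    Σ[ cartesianProductWith g xs ys ] f ≈ Σ[ xs ] (λ x → Σ[ ys ] (λ y → f (g x y)))
  Σ-cartesianProductWith g []       ys f = refl
  Σ-cartesianProductWith g (x ∷ xs) ys f = trans (Σ-++ (map (g x) ys) _ f)
    (+-cong (reflexive (Σ-map ys (g x) f)) (Σ-cartesianProductWith g xs ys f))

  fromℕ-sum : ∀ {A : Set} xs (f : A → ℕ) → fromℕ (sum (map f xs)) ≈ Σ[ xs ] (λ x → fromℕ (f x))
  fromℕ-sum []       f = refl
  fromℕ-sum (x ∷ xs) f = trans (fromℕ-+ (f x) _) (+-congˡ (fromℕ-sum xs f))

-- Pigeonhole arguments for lists without repetition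

unique-⊆⇒↭-++ : ∀ {A : Set} {xs ys : List A} → Unique xs → xs ⊆ ys → ∃ λ zs → ys ↭ xs ++ zs
unique-⊆⇒↭-++ {xs = []} {ys} _ _ = ys , ↭.refl
unique-⊆⇒↭-++ {xs = x ∷ xs} (x∉xs ∷ unique) xs⊆ys with ∈-∃++ (xs⊆ys (here ≡.refl))
... | as , bs , ≡.refl =
  let zs , as++bs↭ = unique-⊆⇒↭-++ unique xs⊆ in zs , ↭-trans x↭ (↭.prep x as++bs↭)
  where
  x↭ = shift x as bs
  xs⊆ : xs ⊆ as ++ bs
  xs⊆ z∈xs with ∈-resp-↭ x↭ (xs⊆ys (there z∈xs))
  ... | here ≡.refl = ⊥-elim (All.lookup x∉xs z∈xs ≡.refl)
  ... | there z∈    = z∈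

unique-⊆⇒length≤ : ∀ {A : Set} {xs ys : List A} → Unique xs → xs ⊆ ys → length xs ℕ.≤ length ys
unique-⊆⇒length≤ {xs = xs} unique xs⊆ys with unique-⊆⇒↭-++ unique xs⊆ys
... | zs , ys↭ = ≡.subst (length xs ℕ.≤_) (≡.trans (≡.sym (length-++ xs)) (≡.sym (↭-length ys↭)))
  (ℕₚ.m≤m+n (length xs) (length zs))

-- Nothing is assumed about repetitions in `ys`; once `xs` has been extracted from it, the bound on
-- the length leaves no room for a remainder.
unique-⊆⇒↭ : ∀ {A : Set} {xs ys : List A} → Unique xs → xs ⊆ ys → length ys ℕ.≤ length xs → xs ↭ ys
unique-⊆⇒↭ {xs = xs} {ys} unique xs⊆ys ∣ys∣≤∣xs∣ with unique-⊆⇒↭-++ unique xs⊆ys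
... | []     , ys↭ = ↭-sym (≡.subst (ys ↭_) (++-identityʳ xs) ys↭)
... | z ∷ zs , ys↭ = ⊥-elim (ℕₚ.m+1+n≰m (length xs)
  (≡.subst (ℕ._≤ length xs) (≡.trans (↭-length ys↭) (length-++ xs)) ∣ys∣≤∣xs∣))

module _ {A : Set} {m} (f : A → Fin m) where

  private
    count : Fin m → List A → ℕ
    count v xs = length (filter (λ x → f x ≟ᶠ v) xs)

  count-accept : ∀ {v} x xs → f x ≡ v → count v (x ∷ xs) ≡ suc (count v xs)
  count-accept {v} x xs fx≡v = ≡.cong length (filter-accept (λ x → f x ≟ᶠ v) fx≡v)

  count-reject : ∀ {v} x xs → f x ≢ v → count v (x ∷ xs) ≡ count v xs
  count-reject {v} x xs fx≢v = ≡.cong length (filter-reject (λ x → f x ≟ᶠ v) fx≢v)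

  count-mono : ∀ {v} x xs → count v xs ℕ.≤ count v (x ∷ xs)
  count-mono {v} x xs with f x ≟ᶠ v
  ... | yes _ = ℕₚ.n≤1+n _
  ... | no  _ = ℕₚ.≤-refl

  count≡0 : ∀ {v} xs → (∀ {x} → x ∈ xs → f x ≢ v) → count v xs ≡ 0
  count≡0 []       _    = ≡.refl
  count≡0 (x ∷ xs) f≢v = ≡.trans (count-reject x xs (f≢v (here ≡.refl))) (count≡0 xs (λ x∈ → f≢v (there x∈)))

  count≥1 : ∀ {x xs} → x ∈ xs → 1 ℕ.≤ count (f x) xs
  count≥1 {x} {_ ∷ xs} (here ≡.refl) = ≡.subst (1 ℕ.≤_) (≡.sym (count-accept x xs ≡.refl)) (s≤s z≤n)
  count≥1 {xs = y ∷ xs} (there x∈xs) = ℕₚ.≤-trans (count≥1 x∈xs) (count-mono y xs)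

  -- Turns the out-degree condition of a `Cycle` into the statement that no source is repeated.
  count≤1⇒unique : ∀ {xs} → (∀ {x} → x ∈ xs → count (f x) xs ℕ.≤ 1) → Unique (map f xs)
  count≤1⇒unique {[]}     _     = []
  count≤1⇒unique {x ∷ xs} cnt≤1 = All.tabulate fx≢
    ∷ count≤1⇒unique (λ x∈ → ℕₚ.≤-trans (count-mono x xs) (cnt≤1 (there x∈)))
    where
    fx≢ : ∀ {v} → v ∈ map f xs → f x ≢ v
    fx≢ v∈ fx≡v with ∈-map⁻ f v∈
    ... | y , y∈xs , ≡.refl = ℕₚ.<-irrefl ≡.refl (ℕₚ.≤-trans
      (≡.subst (2 ℕ.≤_) (≡.sym (count-accept x xs fx≡v)) (s≤s (count≥1 y∈xs))) (cnt≤1 (there y∈xs)))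

toSubset : ∀ {m} → List (Fin m) → Subset m
toSubset xs = Vec.tabulate (λ i → does (mem? _≟ᶠ_ i xs))

∈-toSubset⁺ : ∀ {m} {i : Fin m} {xs} → i ∈ xs → i ∈ˢ toSubset xs
∈-toSubset⁺ {i = i} {xs} i∈xs = Vecₚ.lookup⇒[]= i _
  (≡.trans (Vecₚ.lookup∘tabulate _ i) (dec-true (mem? _≟ᶠ_ i xs) i∈xs))

∈-toSubset⁻ : ∀ {m} {i : Fin m} {xs} → i ∈ˢ toSubset xs → i ∈ xs
∈-toSubset⁻ {i = i} {xs} i∈ˢ
  with mem? _≟ᶠ_ i xs | ≡.trans (≡.sym (Vecₚ.lookup∘tabulate _ i)) (Vecₚ.[]=⇒lookup i∈ˢ)
... | yes i∈xs | _  = i∈xs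
... | no  _    | ()

-- Paths and cycles

module Walks {m} (E : Rel (Fin m) 0ℓ) where

  -- In contrast to the sources of the edges, the last vertex is included. Hence
  -- `Unique (visited p)` says that `p` is a path.
  visited : ∀ {u v} → Star E u v → List (Fin m)
  visited {u} ε       = u ∷ []
  visited {u} (_ ◅ p) = u ∷ visited p

  start-visited : ∀ {u v} (p : Star E u v) → u ∈ visited p
  start-visited ε       = here ≡.refl
  start-visited (_ ◅ _) = here ≡.refl

  end-visited : ∀ {u v} (p : Star E u v) → v ∈ visited p
  end-visited ε       = here ≡.refl
  end-visited (_ ◅ p) = there (end-visited p)

  source-visited : ∀ {u v} (p : Star E u v) {e} → e ∈ edges p → source e ∈ visited p
  source-visited (_ ◅ p) (here ≡.refl) = here ≡.refl
  source-visited (_ ◅ p) (there e∈p)   = there (source-visited p e∈p)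

  target-visited : ∀ {u v} (p : Star E u v) {e} → e ∈ edges p → target e ∈ visited p
  target-visited (_ ◅ p) (here ≡.refl) = there (start-visited p)
  target-visited (_ ◅ p) (there e∈p)   = there (target-visited p e∈p)

  outDegree-end : ∀ {u v} (p : Star E u v) → Unique (visited p) → outDegree (edges p) v ≡ 0
  outDegree-end ε       _             = ≡.refl
  outDegree-end (_ ◅ p) (u∉p ∷ unique) =
    ≡.trans (count-reject source _ (edges p) (All.lookup u∉p (end-visited p))) (outDegree-end p unique)

  outDegree-inner : ∀ {u v w} (p : Star E u v) → Unique (visited p) → w ∈ visited p → w ≢ v →
                    outDegree (edges p) w ≡ 1
  outDegree-inner ε _ (here w≡v) w≢v = ⊥-elim (w≢v w≡v)
  outDegree-inner (_ ◅ p) (u∉p ∷ _) (here ≡.refl) _ = ≡.trans (count-accept source _ (edges p) ≡.refl)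
    (≡.cong suc (count≡0 source (edges p) λ e∈p s≡u → All.lookup u∉p (source-visited p e∈p) (≡.sym s≡u)))
  outDegree-inner (_ ◅ p) (u∉p ∷ unique) (there w∈p) w≢v =
    ≡.trans (count-reject source _ (edges p) (All.lookup u∉p w∈p)) (outDegree-inner p unique w∈p w≢v)

  EdgeOf : List (∃₂ E) → Rel (Fin m) 0ℓ
  EdgeOf es s t = ∃ λ (e : E s t) → (s , t , e) ∈ es

  walkThrough : ∀ {es u v w} (p : Star E u v) → edges p ⊆ es → w ∈ visited p →
                Star (EdgeOf es) u w × Star (EdgeOf es) w v
  walkThrough ε _ (here ≡.refl) = ε , ε
  walkThrough (e ◅ p) p⊆es (here ≡.refl) =
    ε , (e , p⊆es (here ≡.refl)) ◅ proj₂ (walkThrough p (λ x → p⊆es (there x)) (start-visited p))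
  walkThrough (e ◅ p) p⊆es (there w∈p) =
    let u⇝w , w⇝v = walkThrough p (λ x → p⊆es (there x)) w∈p
    in (e , p⊆es (here ≡.refl)) ◅ u⇝w , w⇝v

  -- On a path every vertex except the last has out-degree 1, and `e` supplies the edge missing at
  -- the last one. If `p` is `ε`, the cycle is a loop.
  closePath : ∀ {u v} → E v u → (p : Star E u v) → Unique (visited p) → Cycle E
  closePath {u} {v} e p unique = record
    { vertices = toSubset (visited p)
    ; edgeList = (v , u , e) ∷ edges p
    ; nonempty = u , ∈-toSubset⁺ (start-visited p)
    ; sources∈ = λ { (here ≡.refl) → ∈-toSubset⁺ (end-visited p)
                   ; (there e∈p)   → ∈-toSubset⁺ (source-visited p e∈p) }
    ; targets∈ = λ { (here ≡.refl) → ∈-toSubset⁺ (start-visited p)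
                   ; (there e∈p)   → ∈-toSubset⁺ (target-visited p e∈p) }
    ; outDeg≡1 = λ w∈ → outDeg (∈-toSubset⁻ w∈)
    ; stronglyConnected = λ w∈ x∈ →
        proj₂ (walkThrough p there (∈-toSubset⁻ w∈))
        ◅◅ (e , here ≡.refl) ◅ proj₁ (walkThrough p there (∈-toSubset⁻ x∈))
    }
    where
    outDeg : ∀ {w} → w ∈ visited p → outDegree ((v , u , e) ∷ edges p) w ≡ 1
    outDeg {w} w∈p with w ≟ᶠ v
    ... | yes ≡.refl = ≡.trans (count-accept source _ (edges p) ≡.refl) (≡.cong suc (outDegree-end p unique))
    ... | no  w≢v    = ≡.trans (count-reject source _ (edges p) (λ v≡w → w≢v (≡.sym v≡w)))
                               (outDegree-inner p unique w∈p w≢v)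

  module _ (C : Cycle E) where
    open Cycle C

    private
      lastEdge : ∀ {u v} → Star SubEdge u v → u ≡ v ⊎ (∃ λ e → e ∈ edgeList × target e ≡ v)
      lastEdge ε = inj₁ ≡.refl
      lastEdge ((e , e∈) ◅ p) with lastEdge p
      ... | inj₁ ≡.refl = inj₂ (_ , e∈ , ≡.refl)
      ... | inj₂ found  = inj₂ found

      sources⊆targets : map source edgeList ⊆ map target edgeList
      sources⊆targets v∈ with ∈-map⁻ source v∈
      -- Some walk leads from the target of `e` back to its source. Its last edge enters the source;
      -- if there is none, `e` is a loop and does so itself.
      ... | e , e∈ , ≡.refl with lastEdge (stronglyConnected (targets∈ e∈) (sources∈ e∈))
      ...   | inj₁ t≡s             = ≡.subst (_∈ map target edgeList) t≡s (∈-map⁺ target e∈)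
      ...   | inj₂ (f , f∈ , t≡s) = ≡.subst (_∈ map target edgeList) t≡s (∈-map⁺ target f∈)

    -- The sources are distinct because of the out-degrees, and each of them is a target by strong
    -- connectedness. As there are as many targets as sources, nothing else can occur among the
    -- targets.
    sources↭targets : map source edgeList ↭ map target edgeList
    sources↭targets = unique-⊆⇒↭
      (count≤1⇒unique source (λ e∈ → ℕₚ.≤-reflexive (outDeg≡1 (sources∈ e∈))))
      sources⊆targets
      (ℕₚ.≤-reflexive (≡.trans (length-map target edgeList) (≡.sym (length-map source edgeList))))

-- Weights of closed walks, and potentials

module WeightedGraph (ℝ : CompleteOrderedField) {m} (E : Rel (Fin m) 0ℓ)
                     (weight : ∃₂ E → CompleteOrderedField.Carrier ℝ) where
  open OrderedField ℝ
  open OrderedField.Solver ℝ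
  open Walks E
  open import Relation.Binary.Reasoning.Setoid setoid

  weight[_] : ∀ {u v} → Star E u v → Carrier
  weight[ p ] = Σ[ edges p ] weight

  weight-◅◅ : ∀ {u v w} (p : Star E u v) (q : Star E v w) → weight[ p ◅◅ q ] ≈ weight[ p ] + weight[ q ]
  weight-◅◅ ε       q = sym (+-identityˡ _)
  weight-◅◅ (e ◅ p) q = trans (+-congˡ (weight-◅◅ p q)) (sym (+-assoc _ _ _))

  ClosedWalksZero : Set
  ClosedWalksZero = ∀ {u} (C : Star E u u) → weight[ C ] ≈ 0#

  CyclesZero : Set
  CyclesZero = (C : Cycle E) → Σ[ Cycle.edgeList C ] weight ≈ 0#

  splitAt : ∀ {u v w} (p : Star E u v) → Unique (visited p) → w ∈ visited p →
            ∃₂ λ (q : Star E u w) (r : Star E w v) → weight[ p ] ≈ weight[ q ] + weight[ r ]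
              × Unique (visited q) × Unique (visited r) × visited q ⊆ visited p
  splitAt ε unique (here ≡.refl) = ε , ε , sym (+-identityˡ _) , unique , unique , λ x → x
  splitAt p@(_ ◅ _) unique (here ≡.refl) =
    ε , p , sym (+-identityˡ _) , ([] ∷ []) , unique , λ { (here x) → here x }
  splitAt (e ◅ p) (u∉p ∷ unique) (there w∈p) =
    let q , r , w≈ , uniqueq , uniquer , q⊆p = splitAt p unique w∈p
    in e ◅ q , r , trans (+-congˡ w≈) (sym (+-assoc _ _ _)) ,
       (All.tabulate (λ x∈q → All.lookup u∉p (q⊆p x∈q)) ∷ uniqueq) , uniquer ,
       λ { (here x) → here x ; (there x) → there (q⊆p x) }

  -- The tail is treated first and has become a path when `e` is added. If this path meets `u`, its
  -- part up to `u` and `e` together form one cycle, which is dropped at no change of weight.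
  eraseLoops : CyclesZero → ∀ {u v} (p : Star E u v) →
               ∃ λ (q : Star E u v) → Unique (visited q) × weight[ p ] ≈ weight[ q ]
  eraseLoops isZero ε = ε , ([] ∷ []) , refl
  eraseLoops isZero {u} (e ◅ p) with eraseLoops isZero p
  ... | q , unique , p≈q with mem? _≟ᶠ_ u (visited q)
  ...   | no  u∉q = e ◅ q , (¬Any⇒All¬ _ u∉q ∷ unique) , +-congˡ p≈q
  ...   | yes u∈q with splitAt q unique u∈q
  ...     | q₁ , q₂ , q≈ , unique₁ , unique₂ , _ = q₂ , unique₂ , (begin
    weight (_ , _ , e) + weight[ p ]                    ≈⟨ +-congˡ (trans p≈q q≈) ⟩
    weight (_ , _ , e) + (weight[ q₁ ] + weight[ q₂ ])  ≈⟨ +-assoc _ _ _ ⟨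
    weight (_ , _ , e) + weight[ q₁ ] + weight[ q₂ ]    ≈⟨ +-congʳ (isZero (closePath e q₁ unique₁)) ⟩
    0# + weight[ q₂ ]                                   ≈⟨ +-identityˡ _ ⟩
    weight[ q₂ ]                                        ∎)

  cyclesZero⇒closedWalksZero : CyclesZero → ClosedWalksZero
  cyclesZero⇒closedWalksZero isZero C with eraseLoops isZero C
  ... | ε     , _             , C≈q = C≈q
  ... | _ ◅ q , (u∉q ∷ _) , _   = ⊥-elim (All.lookup u∉q (end-visited q) ≡.refl)

  Σ-↭ : ∀ {A : Set} {xs ys : List A} (f : A → Carrier) → xs ↭ ys → Σ[ xs ] f ≈ Σ[ ys ] f
  Σ-↭ f ↭.refl         = refl
  Σ-↭ f (↭.prep x p)   = +-congˡ (Σ-↭ f p)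
  Σ-↭ f (↭.swap {xs} {ys} x y p) = begin
    f x + (f y + Σ[ xs ] f)  ≈⟨ +-congˡ (+-congˡ (Σ-↭ f p)) ⟩
    f x + (f y + Σ[ ys ] f)
      ≈⟨ solve 3 (λ a b c → a :+ (b :+ c) := b :+ (a :+ c)) (refl) (f x) (f y) (Σ[ ys ] f) ⟩
    f y + (f x + Σ[ ys ] f)  ∎
  Σ-↭ f (↭.trans p q)  = trans (Σ-↭ f p) (Σ-↭ f q)

  -- The edges of a `Cycle` are listed in no particular order, so the differences cannot be
  -- telescoped along a walk. They cancel because the targets are a rearrangement of the sources.
  potential⇒cyclesZero : (φ : Fin m → Carrier) →
                         (∀ e → weight e ≈ φ (target e) - φ (source e)) → CyclesZero
  potential⇒cyclesZero φ weight≈ C = begin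
    Σ[ edgeList ] weight                                               ≈⟨ Σ-cong edgeList weight≈ ⟩
    Σ[ edgeList ] (λ e → φ (target e) - φ (source e))
      ≈⟨ Σ-cong edgeList (λ e → +-congˡ (neg (φ (source e)))) ⟩
    Σ[ edgeList ] (λ e → φ (target e) + (0# - 1#) * φ (source e))      ≈⟨ Σ-+ edgeList _ _ ⟩
    Σ[ edgeList ] (λ e → φ (target e)) + Σ[ edgeList ] (λ e → (0# - 1#) * φ (source e))
      ≈⟨ +-congˡ (trans (Σ-* edgeList _ _) (sym (neg _))) ⟩
    Σ[ edgeList ] (λ e → φ (target e)) - Σ[ edgeList ] (λ e → φ (source e))
      ≈⟨ x≈y⇒x-y≈0 (sym sources≈targets) ⟩
    0#                                                                 ∎
    where
    open Cycle C
    neg : ∀ x → - x ≈ (0# - 1#) * x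
    neg = solve 1 (λ x → :- x := (𝟘 ⊝ 𝟙) :* x) (refl)
    sources≈targets : Σ[ edgeList ] (λ e → φ (source e)) ≈ Σ[ edgeList ] (λ e → φ (target e))
    sources≈targets = begin
      Σ[ edgeList ] (λ e → φ (source e))  ≡⟨ Σ-map edgeList source φ ⟨
      Σ[ map source edgeList ] φ          ≈⟨ Σ-↭ φ (sources↭targets C) ⟩
      Σ[ map target edgeList ] φ          ≡⟨ Σ-map edgeList target φ ⟩
      Σ[ edgeList ] (λ e → φ (target e))  ∎

  ZeroThrough : Fin m → Set
  ZeroThrough s = ∀ {u} (C : Star E u u) → VisitsExactlyOnce s C → weight[ C ] ≈ 0#

  -- The walk ends in `s` and is treated from its end: an edge leaving `s`, followed by a remainder
  -- that never leaves `s`, is a closed walk visiting `s` exactly once.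
  eraseReturns : ∀ {s} → ZeroThrough s → ∀ {u} (p : Star E u s) →
                 ∃ λ (q : Star E u s) → (∀ {e} → e ∈ edges q → source e ≢ s) × weight[ p ] ≈ weight[ q ]
  eraseReturns isZero ε = ε , (λ ()) , refl
  eraseReturns {s} isZero {u} (_◅_ {j = t} e p) with eraseReturns isZero p
  ... | q , avoids , p≈q with u ≟ᶠ s
  ...   | no  u≢s    = e ◅ q , (λ { (here ≡.refl) → u≢s ; (there f∈q) → avoids f∈q }) , +-congˡ p≈q
  ...   | yes ≡.refl = ε , (λ ()) , trans (+-congˡ p≈q) (isZero (e ◅ q) visitsOnce)
    where
    visitsOnce : VisitsExactlyOnce s (e ◅ q)
    visitsOnce = ≡.trans (count-accept (λ v → v) s (map source (edges q)) ≡.refl)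
      (≡.cong suc (count≡0 (λ v → v) (map source (edges q)) avoids′))
      where
      avoids′ : ∀ {v} → v ∈ map source (edges q) → v ≢ s
      avoids′ v∈ with ∈-map⁻ source v∈
      ... | f , f∈q , ≡.refl = avoids f∈q

  zeroThrough⇒closedAtZero : ∀ {s} → ZeroThrough s → (C : Star E s s) → weight[ C ] ≈ 0#
  zeroThrough⇒closedAtZero isZero C with eraseReturns isZero C
  ... | ε     , _      , C≈q = C≈q
  ... | e ◅ q , avoids , _   = ⊥-elim (avoids (here ≡.refl) ≡.refl)

  -- The walk `C` is inserted into a round trip from `s`; the trips with and without it are both
  -- closed at `s`. Connectedness is asked for at sources of edges only, since `Fin m` may contain
  -- vertices outside of the component.
  closedAtZero⇒closedWalksZero : ∀ {s} → (∀ {u v} → E u v → Star E s u × Star E u s) →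
    ((C : Star E s s) → weight[ C ] ≈ 0#) → ClosedWalksZero
  closedAtZero⇒closedWalksZero connected isZero ε         = refl
  closedAtZero⇒closedWalksZero connected isZero C@(e ◅ _) = begin
    weight[ C ]                                     ≈⟨ cancel ⟩
    weight[ p ] + (weight[ C ] + weight[ q ]) - (weight[ p ] + weight[ q ])
      ≈⟨ +-cong (sym (trans (weight-◅◅ p _) (+-congˡ (weight-◅◅ C q)))) (-‿cong (sym (weight-◅◅ p q))) ⟩
    weight[ p ◅◅ C ◅◅ q ] - weight[ p ◅◅ q ]
      ≈⟨ +-cong (isZero (p ◅◅ C ◅◅ q)) (-‿cong (isZero (p ◅◅ q))) ⟩
    0# - 0#                                         ≈⟨ -‿inverseʳ 0# ⟩
    0#                                              ∎
    where
    p = proj₁ (connected e)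
    q = proj₂ (connected e)
    cancel = solve 3 (λ c p q → c := p :+ (c :+ q) ⊝ (p :+ q)) (refl) weight[ C ] weight[ p ] weight[ q ]

-- A Lyapunov function for the time until absorption

module NaturalNumbers where
  open import Data.Nat.Base using (_+_; _*_; _∸_; _^_; _≤_; _<_)
  open import Data.Nat.Properties
  open import Data.Nat.Tactic.RingSolver using (solve-∀)
  open import Relation.Binary.PropositionalEquality using (refl; cong; sym)

  least : {P : ℕ → Set} → Decidable P → ∀ n → P n → ∃[ k ] P k × (∀ {j} → P j → k ≤ j)
  least P? zero    p = 0 , p , λ _ → z≤n
  least P? (suc n) p with P? 0
  ... | yes p₀ = 0 , p₀ , λ _ → z≤n
  ... | no ¬p₀ with least (λ k → P? (suc k)) n p
  ...   | k , pₖ , minimal = suc k , pₖ , λ { {zero} p₀ → ⊥-elim (¬p₀ p₀) ; {suc j} pⱼ → s≤s (minimal pⱼ) }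

  boundedOnFin : ∀ {m} (f : Fin m → ℕ) → ∃[ b ] (∀ i → f i ≤ b)
  boundedOnFin {zero}  f = 0 , λ ()
  boundedOnFin {suc m} f with boundedOnFin (λ i → f (suc i))
  ... | b , f≤b = f zero + b , λ { zero → m≤m+n _ b ; (suc i) → ≤-trans (f≤b i) (m≤n+m b _) }

  length-allFin : ∀ n → length (allFin n) ≡ n
  length-allFin n = length-tabulate {n = n} id

  module _ {A : Set} where

    sum-affine : ∀ xs c a (f : A → ℕ) →
                 sum (map (λ x → c + a * f x) xs) ≡ length xs * c + a * sum (map f xs)
    sum-affine []       c a f = sym (*-zeroʳ a)
    sum-affine (x ∷ xs) c a f rewrite sum-affine xs c a f =
      rearrange c a (f x) (length xs * c) (sum (map f xs))
      where
      rearrange : ∀ c a y l z → c + a * y + (l + a * z) ≡ c + l + a * (y + z)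
      rearrange = solve-∀

    sum-complementary : ∀ xs {f g : A → ℕ} {c} → (∀ x → f x + g x ≡ c) →
                        sum (map f xs) + sum (map g xs) ≡ length xs * c
    sum-complementary []       f+g≡c = refl
    sum-complementary (x ∷ xs) {f} {g} f+g≡c
      rewrite sym (f+g≡c x) | sym (sum-complementary xs {f} {g} {f x + g x} (λ y → ≡.trans (f+g≡c y) (sym (f+g≡c x)))) =
      rearrange (f x) (g x) (sum (map f xs)) (sum (map g xs))
      where
      rearrange : ∀ a b c d → a + c + (b + d) ≡ a + b + (c + d)
      rearrange = solve-∀

    sum-member-≤ : ∀ {x xs} (f : A → ℕ) → x ∈ xs → f x ≤ sum (map f xs)
    sum-member-≤ f (here refl)  = m≤m+n _ _
    sum-member-≤ f (there x∈xs) = ≤-trans (sum-member-≤ f x∈xs) (m≤n+m _ _)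

  module Absorption {m q} (next : Fin m → Fin q → Fin m)
    {Final : Pred (Fin m) 0ℓ} (final? : Decidable Final)
    (final-closed : ∀ {s} x → Final s → Final (next s x)) where

    ReachesIn : ℕ → Pred (Fin m) 0ℓ
    ReachesIn zero    s = Final s
    ReachesIn (suc n) s = ∃[ x ] ReachesIn n (next s x)

    reachesIn? : ∀ n → Decidable (ReachesIn n)
    reachesIn? zero    s = final? s
    reachesIn? (suc n) s = any? (λ x → reachesIn? n (next s x))

    module _ (reaches : ∀ s → ∃[ n ] ReachesIn n s) where

      private
        nearest : ∀ s → ∃[ d ] ReachesIn d s × (∀ {j} → ReachesIn j s → d ≤ j)
        nearest s = least (λ n → reachesIn? n s) (proj₁ (reaches s)) (proj₂ (reaches s))

      distance : Fin m → ℕ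
      distance s = proj₁ (nearest s)

      distance-final : ∀ {s} → Final s → distance s ≡ 0
      distance-final {s} final = n≤0⇒n≡0 (proj₂ (proj₂ (nearest s)) {0} final)

      distance-decreases : ∀ {s} → ¬ Final s → ∃[ x ] distance (next s x) < distance s
      distance-decreases {s} ¬final with nearest s
      ... | zero  , final   , _ = ⊥-elim (¬final final)
      ... | suc d , (x , r) , _ = x , s≤s (proj₂ (proj₂ (nearest (next s x))) r)

      maxDistance : ℕ
      maxDistance = proj₁ (boundedOnFin distance)

      distance≤max : ∀ s → distance s ≤ maxDistance
      distance≤max = proj₂ (boundedOnFin distance)

      height : Fin m → ℕ
      height s = (q + q) ^ (maxDistance ∸ distance s)

      maxHeight : ℕ
      maxHeight = (q + q) ^ maxDistance

      -- Vanishes on the final states, and outside of them decreases by at least 1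
      -- on average in every step: the letter leading closer to a final state
      -- multiplies the height by 2 q.
      potential : Fin m → ℕ
      potential s = maxHeight ∸ height s

      potential≤maxHeight : ∀ s → potential s ≤ maxHeight
      potential≤maxHeight s = m∸n≤m maxHeight (height s)

      potential-final : ∀ {s} → Final s → potential s ≡ 0
      potential-final {s} final rewrite distance-final final = n∸n≡0 maxHeight

      module _ (1≤q : 1 ≤ q) where

        private
          instance
            q+q≢0 : ℕ.NonZero (q + q)
            q+q≢0 = ℕ.>-nonZero (≤-trans 1≤q (m≤m+n q q))

        potential+height : ∀ s → potential s + height s ≡ maxHeight
        potential+height s = m∸n+n≡m (^-monoʳ-≤ (q + q) (m∸n≤m maxDistance (distance s)))

        -- The one letter leading closer already yields at least `2 * q * height s`. Half of this is
        -- the first summand, and the other half is at least `q` as heights are at least 1.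
        height-grows : ∀ {s} → ¬ Final s → q * height s + q ≤ sum (map (λ x → height (next s x)) (allFin q))
        height-grows {s} ¬final with distance-decreases ¬final
        ... | x , closer = begin
          q * height s + q
            ≤⟨ +-monoʳ-≤ (q * height s) (≤-trans (≤-reflexive (sym (*-identityʳ q)))
                 (*-monoʳ-≤ q (m^n>0 (q + q) (maxDistance ∸ distance s)))) ⟩
          q * height s + q * height s            ≡⟨ *-distribʳ-+ (height s) q q ⟨
          (q + q) ^ suc (maxDistance ∸ distance s)   ≤⟨ ^-monoʳ-≤ (q + q) exponent ⟩
          height (next s x)                      ≤⟨ sum-member-≤ (λ x → height (next s x)) (∈-allFin x) ⟩
          sum (map (λ x → height (next s x)) (allFin q)) ∎
          where
          open ≤-Reasoning
          exponent : suc (maxDistance ∸ distance s) ≤ maxDistance ∸ distance (next s x)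
          exponent = ≤-trans (≤-reflexive (sym (+-∸-assoc 1 (distance≤max s)))) (∸-monoʳ-≤ (suc maxDistance) closer)

        potential-drift : ∀ {s} → ¬ Final s →
                          sum (map (λ x → potential (next s x)) (allFin q)) + q ≤ q * potential s
        -- Adding heights to potentials gives `maxHeight` everywhere, which removes the truncated
        -- subtraction.
        potential-drift {s} ¬final = +-cancelʳ-≤ (q * height s) _ _ (begin
          ΣV + q + q * height s              ≡⟨ ≡.trans (+-assoc ΣV q _) (cong (ΣV +_) (+-comm q _)) ⟩
          ΣV + (q * height s + q)            ≤⟨ +-monoʳ-≤ ΣV (height-grows ¬final) ⟩
          ΣV + sum (map (λ x → height (next s x)) (allFin q))
            ≡⟨ sum-complementary (allFin q) (λ x → potential+height (next s x)) ⟩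
          length (allFin q) * maxHeight      ≡⟨ ≡.cong₂ _*_ (length-allFin q) (sym (potential+height s)) ⟩
          q * (potential s + height s)       ≡⟨ *-distribˡ-+ q _ _ ⟩
          q * potential s + q * height s     ∎)
          where
          open ≤-Reasoning
          ΣV = sum (map (λ x → potential (next s x)) (allFin q))

        -- On average, lyapunov T s does not increase when T counts the steps taken
        -- outside of the final states; so it bounds the second moment of T.
        lyapunov : ℕ → Fin m → ℕ
        lyapunov T s = T * T + (2 * T + 1 + 2 * maxHeight) * potential s

        private
          Σ-lyapunov : ∀ T s → sum (map (λ x → lyapunov T (next s x)) (allFin q))
            ≡ q * (T * T) + (2 * T + 1 + 2 * maxHeight) * sum (map (λ x → potential (next s x)) (allFin q))
          Σ-lyapunov T s = ≡.trans (sum-affine (allFin q) (T * T) (2 * T + 1 + 2 * maxHeight) (λ x → potential (next s x)))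
            (cong (λ l → l * (T * T)
                + (2 * T + 1 + 2 * maxHeight) * sum (map (λ x → potential (next s x)) (allFin q)))
              (length-allFin q))

        lyapunov-final : ∀ {s} T → Final s → sum (map (λ x → lyapunov T (next s x)) (allFin q)) ≤ q * lyapunov T s
        lyapunov-final {s} T final = ≤-reflexive (begin
          sum (map (λ x → lyapunov T (next s x)) (allFin q))  ≡⟨ Σ-lyapunov T s ⟩
          q * (T * T) + c * sum (map (λ x → potential (next s x)) (allFin q))
            ≡⟨ cong (λ v → q * (T * T) + c * v) (sum-zero (allFin q)) ⟩
          q * (T * T) + c * 0            ≡⟨ distribute q (T * T) c ⟩
          q * (T * T + c * 0)            ≡⟨ cong (λ v → q * (T * T + c * v)) (potential-final final) ⟨
          q * lyapunov T s               ∎)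
          where
          open ≡.≡-Reasoning
          c = 2 * T + 1 + 2 * maxHeight
          distribute : ∀ a b c → a * b + c * 0 ≡ a * (b + c * 0)
          distribute = solve-∀
          sum-zero : ∀ xs → sum (map (λ x → potential (next s x)) xs) ≡ 0
          sum-zero []       = refl
          sum-zero (x ∷ xs) = ≡.cong₂ _+_ (potential-final (final-closed x final)) (sum-zero xs)

        -- This explains the coefficient in `lyapunov`. Passing from `T` to `suc T` raises the
        -- square by `2 * T + 1` and the coefficient by 2, at a cost of at most
        -- `2 * T + 1 + 2 * maxHeight`. The drift of the potential, weighted by the new coefficient,
        -- gains 2 more than that.
        lyapunov-transient : ∀ {s} T → ¬ Final s →
                             sum (map (λ x → lyapunov (suc T) (next s x)) (allFin q)) ≤ q * lyapunov T s
        lyapunov-transient {s} T ¬final = +-cancelʳ-≤ (c′ * q) _ _ (begin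
          sum (map (λ x → lyapunov (suc T) (next s x)) (allFin q)) + c′ * q
            ≡⟨ cong (_+ c′ * q) (Σ-lyapunov (suc T) s) ⟩
          q * (suc T * suc T) + c′ * ΣV + c′ * q              ≡⟨ factor (q * (suc T * suc T)) c′ ΣV q ⟩
          q * (suc T * suc T) + c′ * (ΣV + q)
            ≤⟨ +-monoʳ-≤ (q * (suc T * suc T)) (*-monoʳ-≤ c′ (potential-drift ¬final)) ⟩
          q * (suc T * suc T) + c′ * (q * V)                  ≡⟨ expand q T V maxHeight ⟩
          q * (T * T + c * V) + q * (1 + 2 * T) + 2 * q * V
            ≤⟨ +-monoʳ-≤ (q * (T * T + c * V) + q * (1 + 2 * T)) (*-monoʳ-≤ (2 * q) (potential≤maxHeight s)) ⟩
          q * (T * T + c * V) + q * (1 + 2 * T) + 2 * q * maxHeight  ≤⟨ m≤m+n _ (2 * q) ⟩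
          q * (T * T + c * V) + q * (1 + 2 * T) + 2 * q * maxHeight + 2 * q  ≡⟨ collect q T V maxHeight ⟩
          q * lyapunov T s + c′ * q                           ∎)
          where
          open ≤-Reasoning
          V  = potential s
          ΣV = sum (map (λ x → potential (next s x)) (allFin q))
          c  = 2 * T + 1 + 2 * maxHeight
          c′ = 2 * suc T + 1 + 2 * maxHeight
          factor : ∀ a b c d → a + b * c + b * d ≡ a + b * (c + d)
          factor = solve-∀
          expand : ∀ q T V K → q * ((1 + T) * (1 + T)) + (2 * (1 + T) + 1 + 2 * K) * (q * V)
            ≡ q * (T * T + (2 * T + 1 + 2 * K) * V) + q * (1 + 2 * T) + 2 * q * V
          expand = solve-∀
          collect : ∀ q T V K → q * (T * T + (2 * T + 1 + 2 * K) * V) + q * (1 + 2 * T) + 2 * q * K + 2 * q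
            ≡ q * (T * T + (2 * T + 1 + 2 * K) * V) + (2 * (1 + T) + 1 + 2 * K) * q
          collect = solve-∀

open NaturalNumbers using (boundedOnFin; length-allFin; module Absorption)

length-cartesianProductWith : ∀ {A B C : Set} (f : A → B → C) xs ys →
                              length (cartesianProductWith f xs ys) ≡ length xs ℕ.* length ys
length-cartesianProductWith f []       ys = ≡.refl
length-cartesianProductWith f (x ∷ xs) ys = ≡.trans (length-++ (map (f x) ys))
  (≡.cong₂ ℕ._+_ (length-map (f x) ys) (length-cartesianProductWith f xs ys))

-- Runs on words and reachable states

module Run {m q} (next : Fin m → Fin q → Fin m) where

  run : ∀ {n} → Fin m → Vec (Fin q) n → Fin m
  run s Vec.[]      = s
  run s (x Vec.∷ w) = next (run s w) x

  -- The last entry of a vector is the letter that is read first.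
  run-∷ʳ : ∀ {n} s (w : Vec (Fin q) n) x → run s (w Vec.∷ʳ x) ≡ run (next s x) w
  run-∷ʳ s Vec.[]      x = ≡.refl
  run-∷ʳ s (y Vec.∷ w) x = ≡.cong (λ t → next t y) (run-∷ʳ s w x)

  run-++ : ∀ {l n} s (u : Vec (Fin q) l) (w : Vec (Fin q) n) → run s (u Vec.++ w) ≡ run (run s w) u
  run-++ s Vec.[]      w = ≡.refl
  run-++ s (x Vec.∷ u) w = ≡.cong (λ t → next t x) (run-++ s u w)

  -- Unlisted successors are added until there are none. The fuel `m` suffices: the length plus the
  -- remaining fuel always exceeds `m`, and a list of more than `m` distinct states is impossible.
  closure : ∀ s → ∃[ xs ] s ∈ xs × (∀ {t} x → t ∈ xs → next t x ∈ xs)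
                 × (∀ {t} → t ∈ xs → ∃₂ λ n (w : Vec (Fin q) n) → run s w ≡ t)
  closure s = grow m (s ∷ []) ([] ∷ []) ℕₚ.≤-refl
                (here ≡.refl) λ { (here ≡.refl) → 0 , Vec.[] , ≡.refl }
    where
    Reached : Pred (Fin m) 0ℓ
    Reached t = ∃₂ λ n (w : Vec (Fin q) n) → run s w ≡ t
    grow : ∀ fuel xs → Unique xs → suc m ℕ.≤ length xs ℕ.+ fuel → s ∈ xs → (∀ {t} → t ∈ xs → Reached t) →
           ∃[ xs ] s ∈ xs × (∀ {t} x → t ∈ xs → next t x ∈ xs) × (∀ {t} → t ∈ xs → Reached t)
    grow zero xs unique large _ _ = ⊥-elim (ℕₚ.<-irrefl ≡.refl (ℕₚ.≤-trans
      (≡.subst (suc m ℕ.≤_) (ℕₚ.+-identityʳ _) large)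
      (≡.subst (length xs ℕ.≤_) (length-allFin m) (unique-⊆⇒length≤ unique (λ {t} _ → ∈-allFin t)))))
    grow (suc fuel) xs unique large s∈xs reached
      with Any.any? (λ t → any? (λ x → ¬? (mem? _≟ᶠ_ (next t x) xs))) xs
    ... | no  closed = xs , s∈xs , (λ {t} x t∈xs → decidable-stable (mem? _≟ᶠ_ (next t x) xs)
                         (λ ∉xs → closed (Any.map (λ { ≡.refl → x , ∉xs }) t∈xs))) , reached
    ... | yes open′ = let t , t∈xs , x , ∉xs = find open′; n , w , eq = reached t∈xs in
      grow fuel (next t x ∷ xs) (¬Any⇒All¬ xs ∉xs ∷ unique)
        (≡.subst (suc m ℕ.≤_) (ℕₚ.+-suc (length xs) fuel) large) (there s∈xs)
        λ { (here ≡.refl) → suc n , x Vec.∷ w , ≡.cong (λ t → next t x) eq ; (there ∈xs) → reached ∈xs }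

-- Averages over words

module Letters (ℝ : CompleteOrderedField) (𝒯 : Transducer ℝ) where
  open OrderedField ℝ hiding (_≟_)
  open OrderedField.Solver ℝ
  open Transducer 𝒯
  open import Relation.Binary.Reasoning.Setoid setoid

  1≤letters : 1 ℕ.≤ numLetters
  1≤letters = ℕₚ.≤-trans (s≤s z≤n) 2≤letters

  numWords : ℕ → Carrier
  numWords n = fromℕ (numLetters ℕ.^ n)

  length-words : ∀ n → length (words 𝒯 n) ≡ numLetters ℕ.^ n
  length-words zero    = ≡.refl
  length-words (suc n) = ≡.trans (length-cartesianProductWith Vec._∷_ (allFin numLetters) (words 𝒯 n))
                                 (≡.cong₂ ℕ._*_ (length-allFin numLetters) (length-words n))

  ∈-words : ∀ {n} (w : Vec Letter n) → w ∈ words 𝒯 n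
  ∈-words Vec.[]      = here ≡.refl
  ∈-words (x Vec.∷ w) = ∈-cartesianProductWith⁺ Vec._∷_ (∈-allFin x) (∈-words w)

  numWords≉0 : ∀ n → ¬ (numWords n ≈ 0#)
  numWords≉0 n = fromℕ≉0 (ℕₚ.m^n>0 numLetters {{ℕ.>-nonZero 1≤letters}} n)

  numWords-+ : ∀ l n → numWords (l ℕ.+ n) ≈ numWords l * numWords n
  numWords-+ l n = trans (reflexive (≡.cong fromℕ (ℕₚ.^-distribˡ-+-* numLetters l n)))
    (fromℕ-* (numLetters ℕ.^ l) (numLetters ℕ.^ n))

  Σ-words-const : ∀ n c → Σ[ words 𝒯 n ] (λ _ → c) ≈ numWords n * c
  Σ-words-const n c = trans (Σ-const (words 𝒯 n) c)
    (*-congʳ (reflexive (≡.cong fromℕ (length-words n))))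

  -- The letter read last is summed innermost, which amounts to conditioning on all earlier letters.
  Σ-words-suc : ∀ n (F : Vec Letter (suc n) → Carrier) →
    Σ[ words 𝒯 (suc n) ] F ≈ Σ[ words 𝒯 n ] (λ w → Σ[ allFin numLetters ] (λ x → F (x Vec.∷ w)))
  Σ-words-suc n F = trans (Σ-cartesianProductWith Vec._∷_ (allFin numLetters) (words 𝒯 n) F)
                          (Σ-swap (allFin numLetters) (words 𝒯 n) (λ x w → F (x Vec.∷ w)))

  Σ-words-++ : ∀ l n (F : Vec Letter (l ℕ.+ n) → Carrier) →
    Σ[ words 𝒯 (l ℕ.+ n) ] F ≈ Σ[ words 𝒯 n ] (λ w → Σ[ words 𝒯 l ] (λ u → F (u Vec.++ w)))
  Σ-words-++ zero    n F = Σ-cong (words 𝒯 n) (λ w → sym (+-identityʳ (F w)))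
  Σ-words-++ (suc l) n F = begin
    Σ[ words 𝒯 (suc l ℕ.+ n) ] F
      ≈⟨ Σ-words-suc (l ℕ.+ n) F ⟩
    Σ[ words 𝒯 (l ℕ.+ n) ] (λ v → Σ[ allFin numLetters ] (λ x → F (x Vec.∷ v)))
      ≈⟨ Σ-words-++ l n _ ⟩
    Σ[ words 𝒯 n ] (λ w → Σ[ words 𝒯 l ] (λ u → Σ[ allFin numLetters ] (λ x → F (x Vec.∷ u Vec.++ w))))
      ≈⟨ Σ-cong (words 𝒯 n) (λ w → sym (Σ-words-suc l (λ u → F (u Vec.++ w)))) ⟩
    Σ[ words 𝒯 n ] (λ w → Σ[ words 𝒯 (suc l) ] (λ u → F (u Vec.++ w))) ∎

  supermartingale : (F : ∀ {n} → Vec Letter n → Carrier) →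
    (∀ {n} (w : Vec Letter n) → Σ[ allFin numLetters ] (λ x → F (x Vec.∷ w)) ≤ fromℕ numLetters * F w) →
    ∀ n → Σ[ words 𝒯 n ] F ≤ numWords n * F Vec.[]
  supermartingale F step zero    = ≤-reflexive (solve 1 (λ f → f :+ 𝟘 := (𝟙 :+ 𝟘) :* f) refl (F Vec.[]))
  supermartingale F step (suc n) = ≤-respˡ-≈ (sym (Σ-words-suc n F)) (≤-trans
    (Σ-mono (words 𝒯 n) step)
    (≤-respˡ-≈ (sym (Σ-* (words 𝒯 n) _ F)) (≤-respʳ-≈ assoc
      (*-monoˡ-≤ _ (fromℕ-nonNegative numLetters) (supermartingale F step n)))))
    where
    assoc : fromℕ numLetters * (numWords n * F Vec.[]) ≈ numWords (suc n) * F Vec.[]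
    assoc = trans (sym (*-assoc _ _ _)) (*-congʳ (sym (fromℕ-* numLetters (numLetters ℕ.^ n))))

  0≤numWords : ∀ n → 0# ≤ numWords n
  0≤numWords n = fromℕ-nonNegative (numLetters ℕ.^ n)

  module _ (n : ℕ) where
    private
      0≤N⁻¹ = ⁻¹-nonNegative (0≤numWords n) (numWords≉0 n)

    𝔼-scale : ∀ f → numWords n * 𝔼 𝒯 n f ≈ Σ[ words 𝒯 n ] f
    𝔼-scale f = trans
      (solve 3 (λ a b c → a :* (b :* c) := b :* (a :* c)) refl (numWords n) (numWords n ⁻¹) (Σ[ words 𝒯 n ] f))
      (*-inverseˡ-cancel _ (numWords≉0 n))

    𝔼-unique : ∀ {f c} → Σ[ words 𝒯 n ] f ≈ numWords n * c → 𝔼 𝒯 n f ≈ c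
    𝔼-unique {f} Σf≈ = *-cancelˡ-≈ (numWords≉0 n) (trans (𝔼-scale f) Σf≈)

    𝔼-≤ : ∀ {f c} → Σ[ words 𝒯 n ] f ≤ numWords n * c → 𝔼 𝒯 n f ≤ c
    𝔼-≤ {f} Σf≤ = *-cancelˡ-≤ (0≤numWords n) (numWords≉0 n) (≤-respˡ-≈ (sym (𝔼-scale f)) Σf≤)

    𝔼-nonNegative : ∀ {f} → (∀ w → 0# ≤ f w) → 0# ≤ 𝔼 𝒯 n f
    𝔼-nonNegative 0≤f = *-nonNegative 0≤N⁻¹ (Σ-nonNegative (words 𝒯 n) 0≤f)

    𝔼-∣∣≤ : ∀ {f g c} → (∀ w → ∣ f w ∣≤ g w) → Σ[ words 𝒯 n ] g ≤ numWords n * c → ∣ 𝔼 𝒯 n f ∣≤ c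
    𝔼-∣∣≤ {f} {g} {c} f≤g Σg≤ = *-cancelˡ-≤ (0≤numWords n) (numWords≉0 n) (≤-respʳ-≈ (sym (𝔼-scale f)) lower)
                              , 𝔼-≤ (≤-trans (Σ-mono (words 𝒯 n) (λ w → proj₂ (f≤g w))) Σg≤)
      where
      0≤Σf+Σg : 0# ≤ Σ[ words 𝒯 n ] f + Σ[ words 𝒯 n ] g
      0≤Σf+Σg = ≤-respʳ-≈ (Σ-+ (words 𝒯 n) f g) (Σ-nonNegative (words 𝒯 n) λ w →
        ≤-respʳ-≈ (solve 2 (λ f g → f ⊝ :- g := f :+ g) refl (f w) (g w)) (x≤y⇒0≤y-x (proj₁ (f≤g w))))
      lower : numWords n * (- c) ≤ Σ[ words 𝒯 n ] f
      lower = ≤-by-difference (+-nonNegative 0≤Σf+Σg (x≤y⇒0≤y-x Σg≤))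
        (solve 4 (λ F G N c → F := N :* (:- c) :+ (F :+ G :+ (N :* c ⊝ G))) refl
          (Σ[ words 𝒯 n ] f) (Σ[ words 𝒯 n ] g) (numWords n) c)

    Σ-shift : ∀ f c → Σ[ words 𝒯 n ] (λ w → f w - c) ≈ numWords n * (𝔼 𝒯 n f - c)
    Σ-shift f c = begin
      Σ[ words 𝒯 n ] (λ w → f w - c)                  ≈⟨ Σ-+ (words 𝒯 n) f _ ⟩
      Σ[ words 𝒯 n ] f + Σ[ words 𝒯 n ] (λ _ → - c)   ≈⟨ +-cong (sym (𝔼-scale f)) (Σ-words-const n (- c)) ⟩
      numWords n * 𝔼 𝒯 n f + numWords n * (- c)       ≈⟨ distribˡ _ _ _ ⟨
      numWords n * (𝔼 𝒯 n f - c)                      ∎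

    𝔼-shift : ∀ f c → 𝔼 𝒯 n (λ w → f w - c) ≈ 𝔼 𝒯 n f - c
    𝔼-shift f c = 𝔼-unique (Σ-shift f c)

    -- When the square is expanded around the mean, the mixed term sums to zero. The offset `y`
    -- serves as the output before a block, or as minus a trial centre.
    Σ-square-shift : ∀ f y → let μ = 𝔼 𝒯 n f in
      Σ[ words 𝒯 n ] (λ w → (y + f w) * (y + f w)) ≈
      numWords n * ((y + μ) * (y + μ)) + Σ[ words 𝒯 n ] (λ w → (f w - μ) * (f w - μ))
    Σ-square-shift f y = begin
      Σ[ words 𝒯 n ] (λ w → (y + f w) * (y + f w))
        ≈⟨ Σ-cong (words 𝒯 n) (λ w → solve 3 (λ y μ f → (y :+ f) :* (y :+ f)
             := ((y :+ μ) :* (y :+ μ) :+ (y :+ μ :+ y :+ μ) :* (f ⊝ μ)) :+ (f ⊝ μ) :* (f ⊝ μ)) refl y μ (f w)) ⟩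
      Σ[ words 𝒯 n ] (λ w → ((y + μ) * (y + μ) + c * (f w - μ)) + (f w - μ) * (f w - μ))
        ≈⟨ trans (Σ-+ (words 𝒯 n) _ _) (+-congʳ (Σ-+ (words 𝒯 n) _ _)) ⟩
      Σ[ words 𝒯 n ] (λ _ → (y + μ) * (y + μ)) + Σ[ words 𝒯 n ] (λ w → c * (f w - μ))
        + Σ[ words 𝒯 n ] (λ w → (f w - μ) * (f w - μ))
        ≈⟨ +-congʳ (+-cong (Σ-words-const n _) (trans (Σ-* (words 𝒯 n) c _) (*-congˡ (Σ-shift f μ)))) ⟩
      numWords n * ((y + μ) * (y + μ)) + c * (numWords n * (μ - μ))
        + Σ[ words 𝒯 n ] (λ w → (f w - μ) * (f w - μ))
        ≈⟨ +-congʳ (solve 4 (λ a c N μ → a :+ c :* (N :* (μ ⊝ μ)) := a) refl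
             (numWords n * ((y + μ) * (y + μ))) c (numWords n) μ) ⟩
      numWords n * ((y + μ) * (y + μ)) + Σ[ words 𝒯 n ] (λ w → (f w - μ) * (f w - μ)) ∎
      where
      μ = 𝔼 𝒯 n f
      c = y + μ + y + μ

    -- The mean is the best centre, so an upper bound for the variance may be computed around any
    -- `c`; later this is `k * fromℕ n`.
    𝕍-scale-≤ : ∀ f c → numWords n * 𝕍 𝒯 n f ≤ Σ[ words 𝒯 n ] (λ w → (f w - c) * (f w - c))
    𝕍-scale-≤ f c = ≤-by-difference
      (*-nonNegative (0≤numWords n) (square-nonNegative (- c + 𝔼 𝒯 n f)))
      (trans (Σ-cong (words 𝒯 n) (λ w → *-cong (+-comm _ _) (+-comm _ _)))
        (trans (Σ-square-shift f (- c)) (trans (+-comm _ _) (+-congʳ (sym (𝔼-scale _))))))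

-- The final component and the steps outside of it

module FinalComponent (ℝ : CompleteOrderedField) (𝒯 : Transducer ℝ)
  (deterministic : Transducer.Deterministic 𝒯) (complete : Transducer.Complete 𝒯) where
  open OrderedField ℝ hiding (_≟_)
  open OrderedField.Solver ℝ
  open Transducer 𝒯
  open Letters ℝ 𝒯 public
  open import Relation.Binary.Reasoning.Setoid setoid

  next : State → Letter → State
  next s x = proj₁ (complete s x)

  out : State → Letter → Carrier
  out s x = δ (x , proj₂ (complete s x))

  open Run next public

  outSum : ∀ {n} → State → Vec Letter n → Carrier
  outSum s Vec.[]      = 0#
  outSum s (x Vec.∷ w) = outSum s w + out (run s w) x

  outSum-∷ʳ : ∀ {n} s (w : Vec Letter n) x → outSum s (w Vec.∷ʳ x) ≈ out s x + outSum (next s x) w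
  outSum-∷ʳ s Vec.[]      x = +-comm _ _
  outSum-∷ʳ s (y Vec.∷ w) x = trans
    (+-cong (outSum-∷ʳ s w x) (reflexive (≡.cong (λ t → out t y) (run-∷ʳ s w x)))) (+-assoc _ _ _)

  outSum-++ : ∀ {l n} s (u : Vec Letter l) (w : Vec Letter n) →
             outSum s (u Vec.++ w) ≈ outSum s w + outSum (run s w) u
  outSum-++ s Vec.[]      w = sym (+-identityʳ _)
  outSum-++ s (x Vec.∷ u) w = trans
    (+-cong (outSum-++ s u w) (reflexive (≡.cong (λ t → out t x) (run-++ s u w)))) (+-assoc _ _ _)

  edge⇒next : ∀ {s t} (e : Edge s t) → next s (proj₁ e) ≡ t
  edge⇒next {s} {t} (x , p) = deterministic s x _ t (proj₂ (complete s x)) p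

  -- `δ` depends on the target and on a proof that the transition exists. Determinism identifies the
  -- targets, after which the two proofs agree by irrelevance of `T`.
  edge⇒out : ∀ {s t} (e : Edge s t) → out s (proj₁ e) ≡ δ e
  edge⇒out {s} {t} (x , p) = δ-unique (proj₂ (complete s x)) (edge⇒next (x , p))
    where
    δ-unique : ∀ {t′} (p′ : T (isTransition s t′ x)) → t′ ≡ t → δ (x , p′) ≡ δ {s} {t} (x , p)
    δ-unique p′ ≡.refl = ≡.cong (λ p → δ (x , p)) (T-irrelevant p′ p)

  nextEdge : ∀ s x → Edge s (next s x)
  nextEdge s x = x , proj₂ (complete s x)

  runWalk : ∀ {n} s (w : Vec Letter n) → Walk s (run s w)
  runWalk s Vec.[]      = ε
  runWalk s (x Vec.∷ w) = runWalk s w ◅◅ nextEdge (run s w) x ◅ ε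

  final-target : ∀ {s t} → InFinalComponent s → Edge s t → InFinalComponent t
  final-target s∈ e r = s∈ r ◅◅ e ◅ ε

  induced : ∀ {s t} → InFinalComponent s → Walk s t → Star FinalEdge s t
  induced s∈ ε       = ε
  induced s∈ (e ◅ p) = (s∈ , final-target s∈ e , e) ◅ induced (final-target s∈ e) p

  excess : Carrier → ∃₂ FinalEdge → Carrier
  excess k (_ , _ , _ , _ , e) = δ e - k

  Σ-excess : ∀ k es → Σ[ es ] (excess k) ≈ δ[ 𝒯 ] es - k * 𝟙[ 𝒯 ] es
  Σ-excess k [] = solve 1 (λ k → 𝟘 := 𝟘 ⊝ k :* 𝟘) refl k
  Σ-excess k (e@(_ , _ , _ , _ , e′) ∷ es) = trans (+-congˡ (Σ-excess k es))
    (solve 4 (λ d k D O → d ⊝ k :+ (D ⊝ k :* O) := d :+ D ⊝ k :* (𝟙 :+ O)) refl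
      (δ e′) k (δ[ 𝒯 ] es) (𝟙[ 𝒯 ] es))

  excess≈0⇒proportional : ∀ {k} es → Σ[ es ] (excess k) ≈ 0# → δ[ 𝒯 ] es ≈ k * 𝟙[ 𝒯 ] es
  excess≈0⇒proportional es Σ≈0 = x-y≈0⇒x≈y (trans (sym (Σ-excess _ es)) Σ≈0)

  proportional⇒excess≈0 : ∀ {k} es → δ[ 𝒯 ] es ≈ k * 𝟙[ 𝒯 ] es → Σ[ es ] (excess k) ≈ 0#
  proportional⇒excess≈0 es prop = trans (Σ-excess _ es) (x≈y⇒x-y≈0 prop)

  module Excess (k : Carrier) = WeightedGraph ℝ FinalEdge (excess k)

  Balanced : Carrier → Set
  Balanced k = Excess.ClosedWalksZero k

  balanced⇒closedWalks : ∀ {k} → Balanced k → ∀ s → ClosedWalksProportional 𝒯 s k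
  balanced⇒closedWalks balanced s C _ = excess≈0⇒proportional (edges C) (balanced C)

  closedWalks⇒balanced : ∀ {k s} → InFinalComponent s → ClosedWalksProportional 𝒯 s k → Balanced k
  closedWalks⇒balanced {k} {s} s∈ prop = closedAtZero⇒closedWalksZero
    (λ { {u} (u∈ , _ , _) → induced s∈ (u∈ s) , induced u∈ (s∈ u) })
    (zeroThrough⇒closedAtZero λ C once → proportional⇒excess≈0 (edges C) (prop C once))
    where open Excess k

  cycles⇒balanced : ∀ {k} → CyclesProportional 𝒯 k → Balanced k
  cycles⇒balanced {k} prop = cyclesZero⇒closedWalksZero λ C → proportional⇒excess≈0 (Cycle.edgeList C) (prop C)
    where open Excess k

  module _ {s₀} (s₀∈ : InFinalComponent s₀) where

    -- The final component consists of the states reachable from `s₀`: these inherit the walks to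
    -- `s₀`, and conversely a state reachable from everywhere is reachable from `s₀`.
    final? : Decidable InFinalComponent
    final? t with closure s₀
    ... | xs , s₀∈xs , closed , reached = map′ ∈⇒final final⇒∈ (mem? _≟ᶠ_ t xs)
      where
      ∈⇒final : t ∈ xs → InFinalComponent t
      ∈⇒final t∈xs r with reached t∈xs
      ... | _ , w , ≡.refl = s₀∈ r ◅◅ runWalk s₀ w
      walk-closed : ∀ {s t} → s ∈ xs → Walk s t → t ∈ xs
      walk-closed s∈xs ε       = s∈xs
      walk-closed s∈xs (e ◅ p) = walk-closed (≡.subst (_∈ xs) (edge⇒next e) (closed (proj₁ e) s∈xs)) p
      final⇒∈ : InFinalComponent t → t ∈ xs
      final⇒∈ t∈ = walk-closed s₀∈xs (t∈ s₀)

    final-closed : ∀ {s} x → InFinalComponent s → InFinalComponent (next s x)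
    final-closed {s} x s∈ = final-target s∈ (nextEdge s x)

    open Absorption next final? final-closed

    reaches : ∀ s → ∃[ n ] ReachesIn n s
    reaches s = along (s₀∈ s)
      where
      along : ∀ {s} → Walk s s₀ → ∃[ n ] ReachesIn n s
      along ε       = 0 , s₀∈
      along (e ◅ p) with along p
      ... | n , r = suc n , proj₁ e , ≡.subst (ReachesIn n) (≡.sym (edge⇒next e)) r

    transientSteps : ∀ {n} → Vec Letter n → ℕ
    transientSteps Vec.[]      = 0
    transientSteps (x Vec.∷ w) with final? (run initial w)
    ... | yes _ = transientSteps w
    ... | no  _ = suc (transientSteps w)

    Φ : ℕ → State → ℕ
    Φ = lyapunov reaches 1≤letters

    -- The offset 2 makes room for the potential and the final output.
    moment : Carrier
    moment = fromℕ (Φ 2 initial)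

    secondMoment : ∀ n → Σ[ words 𝒯 n ] (λ w → let τ = 2 ℕ.+ transientSteps w in fromℕ (τ ℕ.* τ))
                   ≤ numWords n * moment
    secondMoment n = ≤-trans (Σ-mono (words 𝒯 n) square≤F)
                             (supermartingale F step n)
      where
      F : ∀ {n} → Vec Letter n → Carrier
      F w = fromℕ (Φ (2 ℕ.+ transientSteps w) (run initial w))
      square≤F : ∀ (w : Vec Letter n) → let τ = 2 ℕ.+ transientSteps w in fromℕ (τ ℕ.* τ) ≤ F w
      square≤F w = fromℕ-mono-≤ {τ ℕ.* τ} {Φ τ (run initial w)} (ℕₚ.m≤m+n _ _)
        where τ = 2 ℕ.+ transientSteps w
      stepℕ : ∀ {n} (w : Vec Letter n) →
        sum (map (λ x → Φ (2 ℕ.+ transientSteps (x Vec.∷ w)) (run initial (x Vec.∷ w))) (allFin numLetters))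
        ℕ.≤ numLetters ℕ.* Φ (2 ℕ.+ transientSteps w) (run initial w)
      stepℕ w with final? (run initial w)
      ... | yes final = lyapunov-final reaches 1≤letters (2 ℕ.+ transientSteps w) final
      ... | no ¬final = lyapunov-transient reaches 1≤letters (2 ℕ.+ transientSteps w) ¬final
      step : ∀ {n} (w : Vec Letter n) → Σ[ allFin numLetters ] (λ x → F (x Vec.∷ w)) ≤ fromℕ numLetters * F w
      step w = ≤-respˡ-≈ (fromℕ-sum (allFin numLetters)
                 (λ x → Φ (2 ℕ.+ transientSteps (x Vec.∷ w)) (run initial (x Vec.∷ w))))
        (≤-respʳ-≈ (fromℕ-* numLetters (Φ (2 ℕ.+ transientSteps w) (run initial w))) (fromℕ-mono-≤ (stepℕ w)))

-- Expectation and variance in the balanced case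

module Moments (ℝ : CompleteOrderedField) (𝒯 : Transducer ℝ)
  (subsequential : Transducer.Subsequential 𝒯) (complete : Transducer.Complete 𝒯) where
  open OrderedField ℝ hiding (_≟_)
  open OrderedField.Solver ℝ
  open Transducer 𝒯
  open Subsequential subsequential
  open FinalComponent ℝ 𝒯 deterministic complete
  open import Relation.Binary.Reasoning.Setoid setoid

  private
    𝕆 : ∀ {n} → Vec Letter n → Carrier
    𝕆 = Output 𝒯 subsequential complete

  path-run : ∀ {n} (w : Vec Letter n) → proj₁ (path 𝒯 complete w) ≡ run initial w
  path-run Vec.[]      = ≡.refl
  path-run (x Vec.∷ w) = ≡.cong (λ s → next s x) (path-run w)

  path-outSum : ∀ {n} (w : Vec Letter n) →
                Σ[ edges (proj₂ (path 𝒯 complete w)) ] (λ (_ , _ , e) → δ e) ≈ outSum initial w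
  path-outSum Vec.[]      = refl
  path-outSum (x Vec.∷ w) = trans (weight-◅◅ (proj₂ (path 𝒯 complete w)) _)
    (+-cong (path-outSum w) (trans (+-identityʳ _) (reflexive (≡.cong (λ s → out s x) (path-run w)))))
    where open WeightedGraph ℝ Edge (λ (_ , _ , e) → δ e)

  sumList-∷ʳ : ∀ xs y → sumList (xs ∷ʳ y) ≈ sumList xs + y
  sumList-∷ʳ []       y = +-comm y 0#
  sumList-∷ʳ (x ∷ xs) y = trans (+-congˡ (sumList-∷ʳ xs y)) (sym (+-assoc _ _ _))

  Output≈ : ∀ {n} (w : Vec Letter n) → 𝕆 w ≈ outSum initial w + finalOutput (run initial w)
  Output≈ w = trans (sumList-∷ʳ (map (λ (_ , _ , e) → δ e) (edges (proj₂ (path 𝒯 complete w)))) _)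
    (+-cong (path-outSum w) (reflexive (≡.cong finalOutput (path-run w))))

  module _ {s₀} (s₀∈ : InFinalComponent s₀) {k} (balanced : Balanced k) where

    open Excess k

    private
      -- The walk from `s₀` depends on the proof of membership, so the potential is read off from
      -- the decision, on which `φ′-step` can then split. The value outside of the component is
      -- arbitrary.
      φ′ : ∀ {u} → Dec (InFinalComponent u) → Carrier
      φ′ (yes u∈) = weight[ induced s₀∈ (u∈ s₀) ]
      φ′ (no _)   = 0#

      -- The walk to `u` followed by `e`, and the walk to `v`, are closed up by the same walk `r`
      -- back to `s₀`. Both results have weight zero, and `r` cancels.
      φ′-step : ∀ {u v} (u∈? : Dec (InFinalComponent u)) (v∈? : Dec (InFinalComponent v)) (e : Edge u v) →
                InFinalComponent u → δ e - k ≈ φ′ v∈? - φ′ u∈?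
      φ′-step (no u∉)  _        _ u∈ = ⊥-elim (u∉ u∈)
      φ′-step (yes _)  (no v∉)  e u∈ = ⊥-elim (v∉ (final-target u∈ e))
      φ′-step {v = v} (yes u∈) (yes v∈) e _ = begin
        δ e - k
          ≈⟨ solve 4 (λ d p q r → d := ((p :+ (d :+ r)) ⊝ (q :+ r)) :+ (q ⊝ p)) refl
               (δ e - k) weight[ p ] weight[ q ] weight[ r ] ⟩
        (weight[ p ] + (δ e - k + weight[ r ]) - (weight[ q ] + weight[ r ])) + (weight[ q ] - weight[ p ])
          ≈⟨ +-congʳ (+-cong (sym (weight-◅◅ p _)) (-‿cong (sym (weight-◅◅ q r)))) ⟩
        (weight[ p ◅◅ (u∈ , v∈ , e) ◅ r ] - weight[ q ◅◅ r ]) + (weight[ q ] - weight[ p ])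
          ≈⟨ +-congʳ (+-cong (balanced (p ◅◅ (u∈ , v∈ , e) ◅ r)) (-‿cong (balanced (q ◅◅ r)))) ⟩
        (0# - 0#) + (weight[ q ] - weight[ p ])
          ≈⟨ trans (+-congʳ (-‿inverseʳ 0#)) (+-identityˡ _) ⟩
        weight[ q ] - weight[ p ] ∎
        where
        p = induced s₀∈ (u∈ s₀)
        q = induced s₀∈ (v∈ s₀)
        r = induced v∈ (s₀∈ v)

    φ : State → Carrier
    φ u = φ′ (final? s₀∈ u)

    φ-step : ∀ {u v} (e : Edge u v) → InFinalComponent u → δ e - k ≈ φ v - φ u
    φ-step {u} {v} = φ′-step (final? s₀∈ u) (final? s₀∈ v)

    balanced⇒cycles : CyclesProportional 𝒯 k
    balanced⇒cycles C = excess≈0⇒proportional (Cycle.edgeList C)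
      (potential⇒cyclesZero φ (λ { (_ , _ , u∈ , _ , e) → φ-step e u∈ }) C)

    private
      correction : State → Letter → Carrier
      correction s x = out s x - k - (φ (next s x) - φ s)

      -- With the potential subtracted, this stays constant while the run is in the final component;
      -- each step outside changes it by a `correction`.
      deviation : ∀ {n} → Vec Letter n → Carrier
      deviation {n} w = outSum initial w - k * fromℕ n - φ (run initial w)

      deviation-∷ : ∀ {n} x (w : Vec Letter n) →
                    deviation (x Vec.∷ w) ≈ deviation w + correction (run initial w) x
      deviation-∷ {n} x w =
        solve 6 (λ t o k n φ′ φ → t :+ o ⊝ k :* (𝟙 :+ n) ⊝ φ′ := (t ⊝ k :* n ⊝ φ) :+ (o ⊝ k ⊝ (φ′ ⊝ φ))) refl
          (outSum initial w) (out s x) k (fromℕ n) (φ (next s x)) (φ s)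
        where s = run initial w

      M₁ = ∣∣-bounded (deviation Vec.[])
      M₂ = ∣∣-boundedOnFin (λ s → φ s + finalOutput s)
      M₃ = λ s → ∣∣-boundedOnFin (correction s)
      M₄ = ∣∣-boundedOnFin (λ s → proj₁ (M₃ s))

      -- A common bound for the deviation at the start, one correction, and the potential plus final
      -- output at the end. One `M` at the start, one for every step outside and one at the end give
      -- the factor in `Output-bounded`.
      M : Carrier
      M = proj₁ M₁ + (proj₁ M₂ + proj₁ M₄)

      0≤M₂+M₄ = +-nonNegative (proj₁ (proj₂ M₂)) (proj₁ (proj₂ M₄))

      0≤M : 0# ≤ M
      0≤M = +-nonNegative (proj₁ (proj₂ M₁)) 0≤M₂+M₄

      M₂+M₄≤M : proj₁ M₂ + proj₁ M₄ ≤ M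
      M₂+M₄≤M = ≤-by-difference (proj₁ (proj₂ M₁)) (+-comm _ _)

      start-bounded : ∣ deviation Vec.[] ∣≤ M
      start-bounded = ∣∣≤-mono (≤-by-difference 0≤M₂+M₄ refl) (proj₂ (proj₂ M₁))

      end-bounded : ∀ s → ∣ φ s + finalOutput s ∣≤ M
      end-bounded s = ∣∣≤-mono (≤-trans (≤-by-difference (proj₁ (proj₂ M₄)) refl) M₂+M₄≤M) (proj₂ (proj₂ M₂) s)

      correction-bounded : ∀ s x → ∣ correction s x ∣≤ M
      correction-bounded s x = ∣∣≤-mono
        (≤-trans (proj₂ (proj₂ (proj₂ M₄) s))
          (≤-trans (≤-by-difference (proj₁ (proj₂ M₂)) (+-comm _ _)) M₂+M₄≤M))
        (proj₂ (proj₂ (M₃ s)) x)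

      M*suc : ∀ n → M * fromℕ n + M ≈ M * fromℕ (suc n)
      M*suc n = solve 2 (λ M n → M :* n :+ M := M :* (𝟙 :+ n)) refl M (fromℕ n)

      deviation-bounded : ∀ {n} (w : Vec Letter n) →
                          ∣ deviation w ∣≤ M * fromℕ (suc (transientSteps s₀∈ w))
      deviation-bounded Vec.[] = ∣∣≤-mono (≤-reflexive
        (solve 1 (λ M → M := M :* (𝟙 :+ 𝟘)) refl M)) start-bounded
      deviation-bounded (x Vec.∷ w) with final? s₀∈ (run initial w)
      ... | yes final = ∣∣≤-resp (sym (begin
        deviation (x Vec.∷ w)                         ≈⟨ deviation-∷ x w ⟩
        deviation w + correction (run initial w) x
          ≈⟨ +-congˡ (x≈y⇒x-y≈0 (φ-step (nextEdge (run initial w) x) final)) ⟩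
        deviation w + 0#                              ≈⟨ +-identityʳ _ ⟩
        deviation w                                   ∎)) (deviation-bounded w)
      ... | no  _     = ∣∣≤-mono (≤-reflexive (M*suc (suc (transientSteps s₀∈ w))))
        (∣∣≤-resp (sym (deviation-∷ x w)) (∣∣≤-+ (deviation-bounded w) (correction-bounded (run initial w) x)))

    Output-bounded : ∀ {n} (w : Vec Letter n) →
                     ∣ 𝕆 w - k * fromℕ n ∣≤ M * fromℕ (2 ℕ.+ transientSteps s₀∈ w)
    Output-bounded {n} w = ∣∣≤-mono (≤-reflexive (M*suc (suc (transientSteps s₀∈ w))))
      (∣∣≤-resp (sym (begin
        𝕆 w - k * fromℕ n                                      ≈⟨ +-congʳ (Output≈ w) ⟩
        outSum initial w + finalOutput s - k * fromℕ n
          ≈⟨ solve 5 (λ t f k n φ → t :+ f ⊝ k :* n := (t ⊝ k :* n ⊝ φ) :+ (φ :+ f)) refl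
               (outSum initial w) (finalOutput s) k (fromℕ n) (φ s) ⟩
        deviation w + (φ s + finalOutput s)                    ∎))
      (∣∣≤-+ (deviation-bounded w) (end-bounded s)))
      where s = run initial w

    private
      τ² : ∀ {n} → Vec Letter n → Carrier
      τ² w = let τ = 2 ℕ.+ transientSteps s₀∈ w in fromℕ (τ ℕ.* τ)

      Σ-τ² : ∀ n c → 0# ≤ c → Σ[ words 𝒯 n ] (λ w → c * τ² w) ≤ numWords n * (c * moment s₀∈)
      Σ-τ² n c 0≤c = ≤-respˡ-≈ (sym (Σ-* (words 𝒯 n) c τ²))
        (≤-respʳ-≈ (solve 3 (λ c N m → c :* (N :* m) := N :* (c :* m)) refl c (numWords n) (moment s₀∈))
          (*-monoˡ-≤ c 0≤c (secondMoment s₀∈ n)))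

    balanced⇒rate : ExpectedOutputRate 𝒯 subsequential complete k
    balanced⇒rate = M * moment s₀∈ , λ n → ∣∣≤-resp (𝔼-shift n 𝕆 (k * fromℕ n))
      (𝔼-∣∣≤ n (λ w → ∣∣≤-mono (*-monoˡ-≤ M 0≤M (τ≤τ² w)) (Output-bounded w)) (Σ-τ² n M 0≤M))
      where
      -- Since the count is at least 2, its second moment also controls its mean.
      τ≤τ² : ∀ {n} (w : Vec Letter n) → fromℕ (2 ℕ.+ transientSteps s₀∈ w) ≤ τ² w
      τ≤τ² w = fromℕ-mono-≤ {τ} {τ ℕ.* τ} (ℕₚ.m≤m*n τ τ)
        where τ = 2 ℕ.+ transientSteps s₀∈ w

    balanced⇒variance : IsAsymptoticVariance 𝒯 subsequential complete 0#
    balanced⇒variance = b , λ n → ∣∣≤-resp (solve 2 (λ v n → v := v ⊝ 𝟘 :* n) refl (𝕍 𝒯 n 𝕆) (fromℕ n))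
      (≤-trans (≤-respʳ-≈ (solve 0 (:- 𝟘 := 𝟘) refl) (neg-mono-≤ (≤-trans (0≤𝕍 n) (𝕍≤b n)))) (0≤𝕍 n) , 𝕍≤b n)
      where
      b = M * M * moment s₀∈
      0≤𝕍 : ∀ n → 0# ≤ 𝕍 𝒯 n 𝕆
      0≤𝕍 n = 𝔼-nonNegative n (λ w → square-nonNegative _)
      squared : ∀ {n} (w : Vec Letter n) → (𝕆 w - k * fromℕ n) * (𝕆 w - k * fromℕ n) ≤ M * M * τ² w
      squared w = ≤-respʳ-≈ (trans
          (solve 2 (λ M t → M :* t :* (M :* t) := M :* M :* (t :* t)) refl M (fromℕ τ))
          (*-congˡ (sym (fromℕ-* τ τ))))
        (∣∣≤-square (Output-bounded w))
        where τ = 2 ℕ.+ transientSteps s₀∈ w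
      𝕍≤b : ∀ n → 𝕍 𝒯 n 𝕆 ≤ b
      𝕍≤b n = *-cancelˡ-≤ (0≤numWords n) (numWords≉0 n) (≤-trans (𝕍-scale-≤ n 𝕆 (k * fromℕ n))
        (≤-trans (Σ-mono (words 𝒯 n) squared) (Σ-τ² n (M * M) (*-nonNegative 0≤M 0≤M))))

-- Linear growth of the variance in the unbalanced case

module Spread (ℝ : CompleteOrderedField) (𝒯 : Transducer ℝ)
  (subsequential : Transducer.Subsequential 𝒯) (complete : Transducer.Complete 𝒯) where
  open OrderedField ℝ hiding (_≟_)
  open OrderedField.Solver ℝ
  open Transducer 𝒯
  open Subsequential subsequential
  open FinalComponent ℝ 𝒯 deterministic complete
  open Moments ℝ 𝒯 subsequential complete using (Output≈)
  open import Relation.Binary.Reasoning.Setoid setoid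

  Fork : ℕ → Carrier → Pred State 0ℓ
  Fork L d s = ∃₂ λ (u v : Vec Letter L) → run s u ≡ run s v × outSum s u - outSum s v ≈ d

  fork-∷ : ∀ {L d s} → Fork L d s → Fork (suc L) d s
  fork-∷ {d = d} {s} (u , v , u≡v , diff) = x Vec.∷ u , x Vec.∷ v , ≡.cong (λ t → next t x) u≡v , (begin
    outSum s u + out (run s u) x - (outSum s v + out (run s v) x)
      ≡⟨ ≡.cong (λ t → outSum s u + out (run s u) x - (outSum s v + out t x)) (≡.sym u≡v) ⟩
    outSum s u + out (run s u) x - (outSum s v + out (run s u) x)
      ≈⟨ solve 3 (λ a b o → a :+ o ⊝ (b :+ o) := a ⊝ b) refl (outSum s u) (outSum s v) (out (run s u) x) ⟩
    outSum s u - outSum s v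
      ≈⟨ diff ⟩
    d ∎)
    where x = fromℕ< 1≤letters

  fork-∷ʳ : ∀ {L d s t} → Edge s t → Fork L d t → Fork (suc L) d s
  fork-∷ʳ {L} {d} {s} e fork with ≡.subst (Fork L d) (≡.sym (edge⇒next e)) fork
  ... | u , v , u≡v , diff = u Vec.∷ʳ x , v Vec.∷ʳ x ,
        ≡.trans (run-∷ʳ s u x) (≡.trans u≡v (≡.sym (run-∷ʳ s v x))) , (begin
    outSum s (u Vec.∷ʳ x) - outSum s (v Vec.∷ʳ x)
      ≈⟨ +-cong (outSum-∷ʳ s u x) (-‿cong (outSum-∷ʳ s v x)) ⟩
    out s x + outSum (next s x) u - (out s x + outSum (next s x) v)
      ≈⟨ solve 3 (λ a b o → o :+ a ⊝ (o :+ b) := a ⊝ b) refl (outSum (next s x) u) (outSum (next s x) v) (out s x) ⟩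
    outSum (next s x) u - outSum (next s x) v
      ≈⟨ diff ⟩
    d ∎)
    where x = proj₁ e

  -- From each state a walk leads to `s₀`, where the fork follows. These walks differ in length, but
  -- blocks need one length for all states; so both words are prolonged after the fork by common
  -- letters.
  fork-everywhere : ∀ {s₀ L d} → InFinalComponent s₀ → Fork L d s₀ → ∃[ L′ ] ∀ s → Fork L′ d s
  fork-everywhere {s₀} {L} {d} s₀∈ fork = N ℕ.+ L , λ s →
    ≡.subst (λ l → Fork l d s) (same-length s) (pad (N ℕ.∸ ℓ s) (proj₂ (along (s₀∈ s))))
    where
    along : ∀ {s} → Walk s s₀ → ∃[ n ] Fork (n ℕ.+ L) d s
    along ε       = 0 , fork
    along (e ◅ p) = suc (proj₁ (along p)) , fork-∷ʳ e (proj₂ (along p))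
    ℓ : State → ℕ
    ℓ s = proj₁ (along (s₀∈ s))
    N : ℕ
    N = proj₁ (boundedOnFin ℓ)
    pad : ∀ {l s} n → Fork l d s → Fork (n ℕ.+ l) d s
    pad zero    f = f
    pad (suc n) f = fork-∷ (pad n f)
    same-length : ∀ s → N ℕ.∸ ℓ s ℕ.+ (ℓ s ℕ.+ L) ≡ N ℕ.+ L
    same-length s = ≡.trans (≡.sym (ℕₚ.+-assoc (N ℕ.∸ ℓ s) (ℓ s) L))
      (≡.cong (ℕ._+ L) (ℕₚ.m∸n+n≡m (proj₂ (boundedOnFin ℓ) s)))

  module _ (k : Carrier) where
    open Excess k

    -- The length enters through an equation so that two walks of equal length produce words of the
    -- same type, as a fork demands.
    toWord : ∀ {s t n} (p : Star FinalEdge s t) → length (edges p) ≡ n →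
             ∃ λ (w : Vec Letter n) → run s w ≡ t × outSum s w - k * fromℕ n ≈ weight[ p ]
    toWord ε ≡.refl = Vec.[] , ≡.refl , solve 1 (λ k → 𝟘 ⊝ k :* 𝟘 := 𝟘) refl k
    toWord {s} {t} (e@(_ , _ , e′) ◅ p) ≡.refl with toWord p ≡.refl
    ... | w , run≡ , sum≈ = w Vec.∷ʳ x ,
          ≡.trans (run-∷ʳ s w x) (≡.trans (≡.cong (λ r → run r w) (edge⇒next e′)) run≡) , (begin
      outSum s (w Vec.∷ʳ x) - k * fromℕ (suc n)
        ≈⟨ +-congʳ (outSum-∷ʳ s w x) ⟩
      out s x + outSum (next s x) w - k * fromℕ (suc n)
        ≡⟨ ≡.cong₂ (λ o r → o + outSum r w - k * fromℕ (suc n)) (edge⇒out e′) (edge⇒next e′) ⟩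
      δ e′ + outSum _ w - k * fromℕ (suc n)
        ≈⟨ solve 4 (λ d o k n → d :+ o ⊝ k :* (𝟙 :+ n) := (d ⊝ k) :+ (o ⊝ k :* n)) refl
             (δ e′) (outSum _ w) k (fromℕ n) ⟩
      δ e′ - k + (outSum _ w - k * fromℕ n)
        ≈⟨ +-congˡ sum≈ ⟩
      weight[ e ◅ p ] ∎)
      where
      x = proj₁ e′
      n = length (edges p)

    closedWalks⇒fork : ∀ {s} (C D : Star FinalEdge s s) → length (edges C) ≡ length (edges D) →
                       Fork (length (edges D)) (weight[ C ] - weight[ D ]) s
    closedWalks⇒fork {s} C D same with toWord C same | toWord D ≡.refl
    ... | u , run-u , sum-u | v , run-v , sum-v = u , v , ≡.trans run-u (≡.sym run-v) , (begin
      outSum s u - outSum s v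
        ≈⟨ solve 3 (λ a b c → a ⊝ b := (a ⊝ c) ⊝ (b ⊝ c)) refl (outSum s u) (outSum s v) (k * fromℕ n) ⟩
      (outSum s u - k * fromℕ n) - (outSum s v - k * fromℕ n)
        ≈⟨ +-cong sum-u (-‿cong sum-v) ⟩
      weight[ C ] - weight[ D ] ∎)
      where n = length (edges D)

    power : ∀ {s} → ℕ → Star FinalEdge s s → Star FinalEdge s s
    power zero    C = ε
    power (suc n) C = C ◅◅ power n C

    weight-power : ∀ {s} n (C : Star FinalEdge s s) → weight[ power n C ] ≈ fromℕ n * weight[ C ]
    weight-power zero    C = sym (zeroˡ _)
    weight-power (suc n) C = trans (weight-◅◅ C (power n C)) (trans (+-congˡ (weight-power n C))
      (solve 2 (λ n w → w :+ n :* w := (𝟙 :+ n) :* w) refl (fromℕ n) weight[ C ]))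

    length-◅◅ : ∀ {s t u} (p : Star FinalEdge s t) (q : Star FinalEdge t u) →
                length (edges (p ◅◅ q)) ≡ length (edges p) ℕ.+ length (edges q)
    length-◅◅ ε       q = ≡.refl
    length-◅◅ (_ ◅ p) q = ≡.cong suc (length-◅◅ p q)

    length-power : ∀ {s} n (C : Star FinalEdge s s) → length (edges (power n C)) ≡ n ℕ.* length (edges C)
    length-power zero    C = ≡.refl
    length-power (suc n) C = ≡.trans (length-◅◅ C (power n C)) (≡.cong (length (edges C) ℕ.+_) (length-power n C))

  -- Averaging over the last block replaces `g` by `blockMean g`, again a function of the state, so
  -- the induction over blocks is closed. For a suitable `g` this is the scaled variance of the
  -- output.
  sumOfSquares : ∀ n → (State → Carrier) → Carrier
  sumOfSquares n g = Σ[ words 𝒯 n ] λ w →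
    (outSum initial w + g (run initial w)) * (outSum initial w + g (run initial w))

  -- For the two deviations `a` and `b` of a fork, `(a - b)²` is at most `2 (a² + b²)`. Each square
  -- is bounded separately by the sum over all words, as the two words are not assumed distinct;
  -- this gives 4.
  4# : Carrier
  4# = 1# + 1# + (1# + 1#)

  0≤4 : 0# ≤ 4#
  0≤4 = +-nonNegative (+-nonNegative 0≤1 0≤1) (+-nonNegative 0≤1 0≤1)

  module _ {L d} (fork : ∀ s → Fork L d s) where

    private
      Q : Carrier
      Q = numWords L

      blockSum : (State → Carrier) → State → Vec Letter L → Carrier
      blockSum g s u = outSum s u + g (run s u)

      blockMean : (State → Carrier) → State → Carrier
      blockMean g s = 𝔼 𝒯 L (blockSum g s)

    -- The two words of a fork alone contribute d²/4 to the variance within a block.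
    block-spread : ∀ g s → d * d ≤ 4# * Σ[ words 𝒯 L ] (λ u →
      (blockSum g s u - blockMean g s) * (blockSum g s u - blockMean g s))
    block-spread g s with fork s
    ... | u , v , u≡v , diff = ≤-trans
      (≤-by-difference (square-nonNegative (a + b)) (begin
        (1# + 1#) * (a * a + b * b)                    ≈⟨ solve 2 (λ a b → (𝟙 :+ 𝟙) :* (a :* a :+ b :* b)
                                                            := (a ⊝ b) :* (a ⊝ b) :+ (a :+ b) :* (a :+ b)) refl a b ⟩
        (a - b) * (a - b) + (a + b) * (a + b)          ≈⟨ +-congʳ (*-cong a-b≈d a-b≈d) ⟩
        d * d + (a + b) * (a + b)                      ∎))
      (≤-respʳ-≈ (solve 1 (λ S → (𝟙 :+ 𝟙) :* (S :+ S) := (𝟙 :+ 𝟙 :+ (𝟙 :+ 𝟙)) :* S) refl (Σ[ words 𝒯 L ] f))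
        (*-monoˡ-≤ (1# + 1#) (+-nonNegative 0≤1 0≤1)
          (+-mono-≤ (Σ-member-≤ (λ w → square-nonNegative _) (∈-words u))
                    (Σ-member-≤ (λ w → square-nonNegative _) (∈-words v)))))
      where
      μ = blockMean g s
      f : Vec Letter L → Carrier
      f w = (blockSum g s w - μ) * (blockSum g s w - μ)
      a = blockSum g s u - μ
      b = blockSum g s v - μ
      a-b≈d : a - b ≈ d
      a-b≈d = begin
        outSum s u + g (run s u) - μ - (outSum s v + g (run s v) - μ)
          ≡⟨ ≡.cong (λ t → outSum s u + g t - μ - (outSum s v + g (run s v) - μ)) u≡v ⟩
        outSum s u + g (run s v) - μ - (outSum s v + g (run s v) - μ)
          ≈⟨ solve 4 (λ x y g μ → x :+ g ⊝ μ ⊝ (y :+ g ⊝ μ) := x ⊝ y) refl (outSum s u) (outSum s v) (g (run s v)) μ ⟩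
        outSum s u - outSum s v
          ≈⟨ diff ⟩
        d ∎

    -- The law of total variance for the `L` letters read last. Given the word `w` before them,
    -- `Σ-square-shift` separates the square of the conditional mean from the spread within the
    -- block.
    sumOfSquares-block : ∀ n g →
      4# * Q * sumOfSquares n (blockMean g) + numWords n * (d * d) ≤ 4# * sumOfSquares (L ℕ.+ n) g
    sumOfSquares-block n g = ≤-respˡ-≈ lower≈ (≤-respʳ-≈ (sym upper≈) (Σ-mono (words 𝒯 n) step))
      where
      y : Vec Letter n → Carrier
      y w = outSum initial w + blockMean g (run initial w)
      h : Vec Letter n → Vec Letter L → Carrier
      h w = blockSum g (run initial w)
      step : ∀ w → 4# * Q * (y w * y w) + d * d ≤
                   4# * Σ[ words 𝒯 L ] (λ u → (outSum initial w + h w u) * (outSum initial w + h w u))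
      step w = ≤-respʳ-≈ (trans
          (solve 4 (λ f q y V → f :* q :* y :+ f :* V := f :* (q :* y :+ V)) refl 4# Q (y w * y w) _)
          (*-congˡ (sym (Σ-square-shift L (h w) (outSum initial w)))))
        (+-mono-≤ ≤-refl (block-spread g (run initial w)))
      lower≈ : Σ[ words 𝒯 n ] (λ w → 4# * Q * (y w * y w) + d * d) ≈
               4# * Q * sumOfSquares n (blockMean g) + numWords n * (d * d)
      lower≈ = trans (Σ-+ (words 𝒯 n) _ _) (+-cong (Σ-* (words 𝒯 n) (4# * Q) _) (Σ-words-const n (d * d)))
      split : ∀ w u → outSum initial (u Vec.++ w) + g (run initial (u Vec.++ w)) ≈ outSum initial w + h w u
      split w u = trans (+-cong (outSum-++ initial u w) (reflexive (≡.cong g (run-++ initial u w)))) (+-assoc _ _ _)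
      upper≈ : 4# * sumOfSquares (L ℕ.+ n) g ≈ Σ[ words 𝒯 n ] (λ w →
               4# * Σ[ words 𝒯 L ] (λ u → (outSum initial w + h w u) * (outSum initial w + h w u)))
      upper≈ = trans (*-congˡ (trans (Σ-words-++ L n _)
          (Σ-cong (words 𝒯 n) (λ w → Σ-cong (words 𝒯 L) (λ u → *-cong (split w u) (split w u))))))
        (sym (Σ-* (words 𝒯 n) 4# _))

    -- In terms of averages, the mean square is at least `j d² / (4 Q)`: a fork concerns only two of
    -- the `Q` words of a block, hence the division by `Q`.
    sumOfSquares-grows : ∀ j g →
      numWords (j ℕ.* L) * (fromℕ j * (d * d)) ≤ 4# * Q * sumOfSquares (j ℕ.* L) g
    sumOfSquares-grows zero g = ≤-by-difference
      (*-nonNegative (*-nonNegative 0≤4 (0≤numWords L))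
        (Σ-nonNegative (words 𝒯 0) λ w → square-nonNegative (outSum initial w + g (run initial w))))
      (solve 3 (λ N D R → R := N :* (𝟘 :* D) :+ R) refl (numWords 0) (d * d) (4# * Q * sumOfSquares 0 g))
    sumOfSquares-grows (suc j) g = ≤-respˡ-≈ lower≈ (≤-respʳ-≈
        (solve 3 (λ q f S → q :* (f :* S) := f :* q :* S) refl Q 4# (sumOfSquares (L ℕ.+ n) g))
        (*-monoˡ-≤ Q (0≤numWords L) (≤-trans
          (+-mono-≤ (sumOfSquares-grows j (blockMean g)) ≤-refl) (sumOfSquares-block n g))))
      where
      n = j ℕ.* L
      lower≈ : Q * (numWords n * (fromℕ j * (d * d)) + numWords n * (d * d)) ≈
               numWords (L ℕ.+ n) * (fromℕ (suc j) * (d * d))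
      lower≈ = trans
        (solve 4 (λ q N j D → q :* (N :* (j :* D) :+ N :* D) := q :* N :* ((𝟙 :+ j) :* D)) refl
          Q (numWords n) (fromℕ j) (d * d))
        (*-congʳ (sym (numWords-+ L n)))

    boundedVariance⇒fork-trivial : IsAsymptoticVariance 𝒯 subsequential complete 0# → d ≈ 0#
    boundedVariance⇒fork-trivial (b , bound) = x*x≈0⇒x≈0 (archimedean (square-nonNegative d) λ j →
      *-cancelˡ-≤ (0≤numWords (j ℕ.* L)) (numWords≉0 (j ℕ.* L))
        (≤-trans (sumOfSquares-grows j (centred (j ℕ.* L))) (upper (j ℕ.* L))))
      where
      -- The final output depends on the end state alone and the mean only on `n`, so both fit into
      -- the function of the state.
      centred : ℕ → State → Carrier
      centred n s = finalOutput s - 𝔼 𝒯 n (Output 𝒯 subsequential complete)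
      variance≈ : ∀ n → sumOfSquares n (centred n) ≈ numWords n * 𝕍 𝒯 n (Output 𝒯 subsequential complete)
      variance≈ n = trans (Σ-cong (words 𝒯 n) (λ w → *-cong (same w) (same w))) (sym (𝔼-scale n _))
        where
        same : ∀ w → outSum initial w + centred n (run initial w) ≈
                     Output 𝒯 subsequential complete w - 𝔼 𝒯 n (Output 𝒯 subsequential complete)
        same w = trans (sym (+-assoc _ _ _)) (+-congʳ (sym (Output≈ w)))
      upper : ∀ n → 4# * Q * sumOfSquares n (centred n) ≤ numWords n * (4# * Q * b)
      upper n = ≤-respˡ-≈ (*-congˡ (sym (variance≈ n))) (≤-respˡ-≈ (swapN (𝕍 𝒯 n (Output 𝒯 subsequential complete)))
          (*-monoˡ-≤ (numWords n) (0≤numWords n) (*-monoˡ-≤ (4# * Q) (*-nonNegative 0≤4 (0≤numWords L))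
            (≤-respˡ-≈ (solve 2 (λ v n → v ⊝ 𝟘 :* n := v) refl _ (fromℕ n)) (proj₂ (bound n))))))
        where
        swapN : ∀ v → numWords n * (4# * Q * v) ≈ 4# * Q * (numWords n * v)
        swapN v = solve 3 (λ N q v → N :* (q :* v) := q :* (N :* v)) refl (numWords n) (4# * Q) v

  -- The candidate for `k` is the mean output along one non-empty closed walk `loop`. Repeating `C`
  -- and `loop` as often as the other one is long makes the lengths equal; the resulting fork must
  -- be trivial, and `loop` has excess zero.
  boundedVariance⇒balanced : ∀ {s₀} → InFinalComponent s₀ →
    IsAsymptoticVariance 𝒯 subsequential complete 0# → ∃[ k ] Balanced k
  boundedVariance⇒balanced {s₀} s₀∈ bounded = k , closedAtZero⇒closedWalksZero
    (λ { {u} (u∈ , _ , _) → induced s₀∈ (u∈ s₀) , induced u∈ (s₀∈ u) }) closed≈0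
    where
    x₀ = fromℕ< 1≤letters
    loop : Star FinalEdge s₀ s₀
    loop = induced s₀∈ (nextEdge s₀ x₀ ◅ s₀∈ (next s₀ x₀))
    𝟙≉0 : ¬ (𝟙[ 𝒯 ] (edges loop) ≈ 0#)
    𝟙≉0 = 1≤x⇒x≉0 (≤-by-difference
      (Σ-nonNegative (edges (induced (final-target s₀∈ (nextEdge s₀ x₀)) (s₀∈ (next s₀ x₀)))) (λ _ → 0≤1)) refl)
    k : Carrier
    k = δ[ 𝒯 ] (edges loop) * 𝟙[ 𝒯 ] (edges loop) ⁻¹
    open Excess k
    loop≈0 : weight[ loop ] ≈ 0#
    loop≈0 = proportional⇒excess≈0 (edges loop) (sym (begin
      k * 𝟙[ 𝒯 ] (edges loop)
        ≈⟨ solve 3 (λ d i o → d :* i :* o := i :* (o :* d)) refl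
             (δ[ 𝒯 ] (edges loop)) (𝟙[ 𝒯 ] (edges loop) ⁻¹) (𝟙[ 𝒯 ] (edges loop)) ⟩
      𝟙[ 𝒯 ] (edges loop) ⁻¹ * (𝟙[ 𝒯 ] (edges loop) * δ[ 𝒯 ] (edges loop))
        ≈⟨ *-inverseˡ-cancel _ 𝟙≉0 ⟩
      δ[ 𝒯 ] (edges loop) ∎))
    closed≈0 : (C : Star FinalEdge s₀ s₀) → weight[ C ] ≈ 0#
    closed≈0 C = *-cancelˡ-≈ (fromℕ≉0 {length (edges loop)} (s≤s z≤n)) (begin
      fromℕ (length (edges loop)) * weight[ C ]  ≈⟨ weight-power k (length (edges loop)) C ⟨
      weight[ C′ ]                               ≈⟨ x-y≈0⇒x≈y fork≈0 ⟩
      weight[ loop′ ]                            ≈⟨ weight-power k (length (edges C)) loop ⟩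
      fromℕ (length (edges C)) * weight[ loop ]  ≈⟨ trans (*-congˡ loop≈0) (zeroʳ _) ⟩
      0#                                         ≈⟨ zeroʳ _ ⟨
      fromℕ (length (edges loop)) * 0#           ∎)
      where
      C′    = power k (length (edges loop)) C
      loop′ = power k (length (edges C)) loop
      same-length : length (edges C′) ≡ length (edges loop′)
      same-length = ≡.trans (length-power k (length (edges loop)) C)
        (≡.trans (ℕₚ.*-comm (length (edges loop)) (length (edges C))) (≡.sym (length-power k (length (edges C)) loop)))
      fork≈0 : weight[ C′ ] - weight[ loop′ ] ≈ 0#
      fork≈0 = boundedVariance⇒fork-trivial
        (proj₂ (fork-everywhere s₀∈ (closedWalks⇒fork k C′ loop′ same-length))) bounded

theorem3p1 :
    (ℝ : CompleteOrderedField) (𝒯 : Transducer ℝ) →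
    let open CompleteOrderedField ℝ
        open Transducer 𝒯 in
    (subsequential : Subsequential) (complete : Complete) →
    FinallyConnected → FinallyAperiodic →
    let a = IsAsymptoticVariance 𝒯 subsequential complete 0#
        b = ∃[ s ] InFinalComponent s × (∃[ k ] ClosedWalksProportional 𝒯 s k)
        c = ∃[ k ] CyclesProportional 𝒯 k in
    (a ⇔ b) × (b ⇔ c) ×
    (∀ k →
      (∃[ s ] InFinalComponent s × ClosedWalksProportional 𝒯 s k) ⊎ CyclesProportional 𝒯 k →
      ExpectedOutputRate 𝒯 subsequential complete k ×
      (∀ s → InFinalComponent s → ClosedWalksProportional 𝒯 s k))
theorem3p1 ℝ 𝒯 subsequential complete (s₀ , s₀∈) _ =
  mk⇔ (λ a → let k , balanced = boundedVariance⇒balanced s₀∈ a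
             in s₀ , s₀∈ , k , λ {_} → balanced⇒closedWalks balanced s₀)
      (λ { (s , s∈ , k , prop) → balanced⇒variance s₀∈ (closedWalks⇒balanced s∈ prop) }) ,
  mk⇔ (λ { (s , s∈ , k , prop) → k , balanced⇒cycles s₀∈ (closedWalks⇒balanced s∈ prop) })
      (λ { (k , prop) → s₀ , s₀∈ , k , λ {_} → balanced⇒closedWalks (cycles⇒balanced prop) s₀ }) ,
  λ k b⊎c → let balanced = toBalanced k b⊎c
            in balanced⇒rate s₀∈ balanced , λ s _ {_} → balanced⇒closedWalks balanced s
  where
  open FinalComponent ℝ 𝒯 (Transducer.Subsequential.deterministic subsequential) complete
  open Moments ℝ 𝒯 subsequential complete
  open Spread ℝ 𝒯 subsequential complete
  toBalanced : ∀ k → (∃[ s ] Transducer.InFinalComponent 𝒯 s × ClosedWalksProportional 𝒯 s k)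
                     ⊎ CyclesProportional 𝒯 k → Balanced k
  toBalanced k (inj₁ (s , s∈ , prop)) = closedWalks⇒balanced s∈ prop
  toBalanced k (inj₂ prop)            = cycles⇒balanced prop
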